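{- Let $\mathbf{M}$ be a Markov chain with $n$ states. Given an $\ell_1$ distance tester with time complexity $T(n,\epsilon,\delta)$ and gap $f$, and an oracle next_node for $\mathbf{M}$, there exists a test (taking parameters $t,\epsilon,\delta$) with time complexity $O(n\,t\cdot T(n,\epsilon,\delta/n))$ and the following behavior: if $\mathbf{M}$ is $(f(\epsilon)/2,t)$-mixing then $\Pr[\mathbf{M}\text{ is accepted}]>1-\delta$; if $\mathbf{M}$ is not $(\epsilon,t)$-mixing then $\Pr[\mathbf{M}\text{ is accepted}]<\delta$.
   Context: A Markov chain on $n$ states is represented by its $n\times n$ transition probability matrix $\mathbf{M}$. For a state $u$, $\mathbf{e}_u$ is the row vector with a one in position $u$ and zeros elsewhere, so $\mathbf{e}_u\mathbf{M}^t$ is the distribution of the endpoint of a $t$-step random walk started at $u$. $\|\mathbf{v}\|_1=\sum_i|v_i|$. The chain $\mathbf{M}$ is $(\epsilon,t)$-mixing if there exists a distribution $\mathbf{s}$ such that $\|\mathbf{e}_u\mathbf{M}^t-\mathbf{s}\|_1\le\epsilon$ for all states $u$. The oracle next_node, on input a state $u$, responds at unit cost with a state $v$ with probability $\mathbf{M}(u,v)$ (independently across calls). An $\ell_1$ distance tester with gap $f$ and time complexity $T(n,\epsilon,\delta)$ is a randomized algorithm which, given parameters $\epsilon,\delta$ and oracle (sample) access to two distributions over the same $n$-element set, runs in time $T(n,\epsilon,\delta)$ (each sample counted at unit cost) and decides with confidence $1-\delta$ whether their $\ell_1$ distance is at most $f(\epsilon)$ (in which case it accepts) or more than $\epsilon$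 (in which case it rejects). -}

module Defs where

open import Algebra.Bundles using (CommutativeRing; Semiring)
open import Data.Bool.Base using (Bool; true; false; if_then_else_)
import Data.Bool.Properties as Bool
open import Data.Fin.Base using (Fin; zero; suc; toℕ; fromℕ<)
import Data.Fin.Properties as Fin
open import Data.List.Base using (List; []; _∷_; _++_)
open import Data.Nat.Base as ℕ using (ℕ; zero; suc; NonZero)
open import Data.Nat.DivMod using (_/_; _%_)
import Data.Nat.Properties as ℕ
open import Data.Product.Base using (Σ-syntax; _×_; _,_)
open import Data.Empty using (⊥)
open import Data.Unit.Base using (⊤)
open import Data.Vec.Base as Vec using (Vec; lookup; _[_]≔_)
import Data.Vec.Functional as Vector
open Vector using (Vector)
open import Level using (Level; _⊔_) renaming (suc to lsuc)
open import Relation.Binary.Core using (Rel)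
open import Relation.Binary.Structures using (IsDecTotalOrder)
open import Relation.Nullary.Decidable.Core using (Dec; yes; no; does)
open import Relation.Nullary.Negation.Core using (¬_)

-- Linearly ordered fields; the classical real numbers are the intended
-- instance.  The order is decidable because the machines below branch on
-- comparisons of scalars.  The inverse is total, with the convention 0⁻¹ = 0.

record OrderedField (c ℓ₁ ℓ₂ : Level) : Set (lsuc (c ⊔ ℓ₁ ⊔ ℓ₂)) where
  infix  4 _≤_
  infix  8 _⁻¹
  field
    commutativeRing : CommutativeRing c ℓ₁
  open CommutativeRing commutativeRing public hiding (zero)
  field
    _≤_             : Rel Carrier ℓ₂
    _⁻¹             : Carrier → Carrier
    isDecTotalOrder : IsDecTotalOrder _≈_ _≤_
    +-monoʳ-≤       : ∀ x {y z} → y ≤ z → x + y ≤ x + z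
    *-nonNegative   : ∀ {x y} → 0# ≤ x → 0# ≤ y → 0# ≤ x * y
    0≉1             : ¬ (0# ≈ 1#)
    ⁻¹-cong         : ∀ {x y} → x ≈ y → x ⁻¹ ≈ y ⁻¹
    *-inverseʳ      : ∀ {x} → ¬ (x ≈ 0#) → x * x ⁻¹ ≈ 1#
    0⁻¹≈0           : 0# ⁻¹ ≈ 0#

  open IsDecTotalOrder isDecTotalOrder public using (_≤?_)
  open import Relation.Binary.Construct.NonStrictToStrict _≈_ _≤_ public
    using (_<_)
  open import Algebra.Definitions.RawSemiring (Semiring.rawSemiring semiring) public
    using (sum) renaming (_×_ to _·_)

  infixl 7 _÷_
  _÷_ : Carrier → Carrier → Carrier
  x ÷ y = x * y ⁻¹

  ι : ℕ → Carrier
  ι k = k · 1#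

  ∣_∣ : Carrier → Carrier
  ∣ x ∣ = if does (0# ≤? x) then x else - x

-- A probabilistic unit-cost real RAM with an oracle, programmed in a structured
-- language.  There are a registers for natural numbers, b registers for
-- scalars, and one unbounded memory of each sort, addressed by naturals.

data NatOp : Set where
  add monus mul quot rem : NatOp

data ScalarOp : Set where
  add sub mul div : ScalarOp

data Instr (a b : ℕ) : Set where
  -- x := k,  x := y ⊙ z,  x := mem[y],  mem[x] := y
  const : (x : Fin a) (k : ℕ) → Instr a b
  op    : (x : Fin a) (⊙ : NatOp) (y z : Fin a) → Instr a b
  load  : (x y : Fin a) → Instr a b
  store : (x y : Fin a) → Instr a b
  -- the same for scalars, with addresses held in natural-number registers
  cast   : (r : Fin b) (x : Fin a) → Instr a b
  opˢ    : (r : Fin b) (⊙ : ScalarOp) (s u : Fin b) → Instr a b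
  loadˢ  : (r : Fin b) (y : Fin a) → Instr a b
  storeˢ : (x : Fin a) (s : Fin b) → Instr a b
  -- x := 1 if r ≤ s, and x := 0 otherwise
  leq   : (x : Fin a) (r s : Fin b) → Instr a b
  -- x := a uniformly random element of {0, …, y - 1}; no effect if y = 0
  rand  : (x y : Fin a) → Instr a b
  -- x := a fresh response of the oracle to query y; no effect if y is not a
  -- valid query
  query : (x y : Fin a) → Instr a b
  -- the tests are for x being nonzero
  branch : (x : Fin a) (yes no : List (Instr a b)) → Instr a b
  while  : (x : Fin a) (body : List (Instr a b)) → Instr a b

-- A program with i natural and j scalar inputs.  Natural-number register 0 is
-- the output register; it is followed by the inputs and the work registers.

record Program (i j : ℕ) : Set where
  field
    workℕ workˢ : ℕ
    code        : List (Instr (suc (i ℕ.+ workℕ)) (j ℕ.+ workˢ))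

module Model {c ℓ₁ ℓ₂ : Level} (F : OrderedField c ℓ₁ ℓ₂) where
  open OrderedField F

  ----------------------------------------------------------------------
  -- Distributions and Markov chains

  Matrix : ℕ → ℕ → Set c
  Matrix m n = Fin m → Vector Carrier n

  IsDistribution : ∀ {n} → Vector Carrier n → Set (ℓ₁ ⊔ ℓ₂)
  IsDistribution v = (∀ i → 0# ≤ v i) × sum v ≈ 1#

  IsMarkovChain : ∀ {n} → Matrix n n → Set (ℓ₁ ⊔ ℓ₂)
  IsMarkovChain M = ∀ u → IsDistribution (M u)

  e : ∀ {n} → Fin n → Vector Carrier n
  e u i = if does (u Fin.≟ i) then 1# else 0#

  infixl 6 _⊖_
  infixl 7 _∙_ _⊗_
  infixr 8 _^_

  _∙_ : ∀ {m n} → Vector Carrier m → Matrix m n → Vector Carrier n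
  (v ∙ A) j = sum (λ i → v i * A i j)

  _⊗_ : ∀ {l m n} → Matrix l m → Matrix m n → Matrix l n
  (A ⊗ B) i = A i ∙ B

  _^_ : ∀ {n} → Matrix n n → ℕ → Matrix n n
  M ^ zero  = e
  M ^ suc t = M ⊗ M ^ t

  ∥_∥₁ : ∀ {n} → Vector Carrier n → Carrier
  ∥ v ∥₁ = sum (λ i → ∣ v i ∣)

  _⊖_ : ∀ {n} → Vector Carrier n → Vector Carrier n → Vector Carrier n
  _⊖_ = Vector.zipWith _-_

  IsMixing : ∀ {n} → Matrix n n → Carrier → ℕ → Set (c ⊔ ℓ₁ ⊔ ℓ₂)
  IsMixing {n} M ε t =
    Σ[ s ∈ Vector Carrier n ] (IsDistribution s × ∀ u → ∥ e u ∙ M ^ t ⊖ s ∥₁ ≤ ε)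

  ----------------------------------------------------------------------
  -- Execution of programs

  truth : Bool → ℕ
  truth b = if b then 1 else 0

  nonzero : ℕ → Bool
  nonzero zero    = false
  nonzero (suc _) = true

  evalℕ : NatOp → ℕ → ℕ → ℕ
  evalℕ add   x y       = x ℕ.+ y
  evalℕ monus x y       = x ℕ.∸ y
  evalℕ mul   x y       = x ℕ.* y
  evalℕ quot  x zero    = 0
  evalℕ quot  x (suc y) = x / suc y
  evalℕ rem   x zero    = x
  evalℕ rem   x (suc y) = x % suc y

  evalˢ : ScalarOp → Carrier → Carrier → Carrier
  evalˢ add = _+_
  evalˢ sub = _-_
  evalˢ mul = _*_
  evalˢ div = _÷_

  record State (a b : ℕ) : Set c where
    field
      regs  : Vec ℕ a
      regsˢ : Vec Carrier b
      mem   : ℕ → ℕ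
      memˢ  : ℕ → Carrier
  open State

  _[_↦_] : ∀ {ℓ} {A : Set ℓ} → (ℕ → A) → ℕ → A → (ℕ → A)
  (f [ i ↦ v ]) j = if does (j ℕ.≟ i) then v else f j

  -- The instructions still to be executed, and the current state.
  Config : ℕ → ℕ → Set c
  Config a b = List (Instr a b) × State a b

  -- One step of a machine whose oracle takes queries in Fin m and gives
  -- responses in Fin n.
  data Step (m n a b : ℕ) : Set c where
    halt    : (accept : Bool) → Step m n a b
    next    : Config a b → Step m n a b
    uniform : ∀ k → (Fin (suc k) → Config a b) → Step m n a b
    respond : Fin m → (Fin n → Config a b) → Step m n a b

  module _ {a b : ℕ} where

    infixl 6 _⟨_≔_⟩ _⟨_≔ˢ_⟩

    _⟨_≔_⟩ : State a b → Fin a → ℕ → State a b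
    σ ⟨ x ≔ v ⟩ = record σ { regs = regs σ [ x ]≔ v }

    _⟨_≔ˢ_⟩ : State a b → Fin b → Carrier → State a b
    σ ⟨ r ≔ˢ v ⟩ = record σ { regsˢ = regsˢ σ [ r ]≔ v }

  step : ∀ {m n a b} → Config (suc a) b → Step m n (suc a) b
  step ([] , σ) = halt (nonzero (lookup (regs σ) zero))
  step {m} {n} {a} {b} (instr ∷ K , σ) = exec instr
    where
    reg : Fin (suc a) → ℕ
    reg = lookup (regs σ)

    regˢ : Fin b → Carrier
    regˢ = lookup (regsˢ σ)

    draw : Fin (suc a) → ℕ → Step m n (suc a) b
    draw x zero    = next (K , σ)
    draw x (suc k) = uniform k (λ v → K , σ ⟨ x ≔ toℕ v ⟩)

    ask : Fin (suc a) → ∀ {q} → Dec (q ℕ.< m) → Step m n (suc a) b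
    ask x (yes q<m) = respond (fromℕ< q<m) (λ v → K , σ ⟨ x ≔ toℕ v ⟩)
    ask x (no  _)   = next (K , σ)

    exec : Instr (suc a) b → Step m n (suc a) b
    exec (const x k)    = next (K , σ ⟨ x ≔ k ⟩)
    exec (op x ⊙ y z)   = next (K , σ ⟨ x ≔ evalℕ ⊙ (reg y) (reg z) ⟩)
    exec (load x y)     = next (K , σ ⟨ x ≔ mem σ (reg y) ⟩)
    exec (store x y)    = next (K , record σ { mem = mem σ [ reg x ↦ reg y ] })
    exec (cast r x)     = next (K , σ ⟨ r ≔ˢ ι (reg x) ⟩)
    exec (opˢ r ⊙ s u)  = next (K , σ ⟨ r ≔ˢ evalˢ ⊙ (regˢ s) (regˢ u) ⟩)
    exec (loadˢ r y)    = next (K , σ ⟨ r ≔ˢ memˢ σ (reg y) ⟩)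
    exec (storeˢ x s)   = next (K , record σ { memˢ = memˢ σ [ reg x ↦ regˢ s ] })
    exec (leq x r s)    = next (K , σ ⟨ x ≔ truth (does (regˢ r ≤? regˢ s)) ⟩)
    exec (rand x y)     = draw x (reg y)
    exec (query x y)    = ask x (reg y ℕ.<? m)
    exec (branch x P Q) = next ((if nonzero (reg x) then P else Q) ++ K , σ)
    exec (while x B)    =
      next ((if nonzero (reg x) then B ++ while x B ∷ K else K) , σ)

  module _ {m n a b : ℕ} where

    Always : (Config a b → Set) → Step m n a b → Set
    Always P (halt _)      = ⊤
    Always P (next κ)      = P κ
    Always P (uniform _ f) = ∀ v → P (f v)
    Always P (respond _ f) = ∀ v → P (f v)

    -- The expected value of X after a step, query q to the oracle being answered
    -- according to the distribution O q, independently of everything else;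
    -- h is the value on halting.
    expect : Matrix m n → (h : Bool → Carrier) (X : Config a b → Carrier) →
             Step m n a b → Carrier
    expect O h X (halt accept) = h accept
    expect O h X (next κ)      = X κ
    expect O h X (uniform k f) = sum (λ v → X (f v)) ÷ ι (suc k)
    expect O h X (respond q f) = sum (λ v → O q v * X (f v))

  -- Every run, whatever the random choices and the oracle's responses, halts
  -- after at most N steps.  Halting is itself a step.
  HaltsWithin : (m n : ℕ) → ∀ {a b} → ℕ → Config (suc a) b → Set
  HaltsWithin m n zero    κ = ⊥
  HaltsWithin m n (suc N) κ = Always (HaltsWithin m n N) (step {m} {n} κ)

  -- The probability that a run halts with the given answer after at most N steps.
  prob : ∀ {m n a b} → Matrix m n → ℕ → Bool → Config (suc a) b → Carrier
  prob O zero    answer κ = 0#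
  prob O (suc N) answer κ =
    expect O (λ accept → if does (accept Bool.≟ answer) then 1# else 0#)
           (prob O N answer) (step κ)

  initial : ∀ {i j} (P : Program i j) → Vec ℕ i → Vec Carrier j →
            Config (suc (i ℕ.+ Program.workℕ P)) (j ℕ.+ Program.workˢ P)
  initial P xs rs = Program.code P , record
    { regs  = 0 Vec.∷ (xs Vec.++ Vec.replicate _ 0)
    ; regsˢ = rs Vec.++ Vec.replicate _ 0#
    ; mem   = λ _ → 0
    ; memˢ  = λ _ → 0#
    }

  ----------------------------------------------------------------------
  -- ℓ₁ distance testers

  -- Access to two distributions: query 0 draws from p and query 1 from q.
  samples : ∀ {n} → Vector Carrier n → Vector Carrier n → Matrix 2 n
  samples p q = p Vector.∷ q Vector.∷ Vector.[]

  record L1Tester (f : Carrier → Carrier) (T : ℕ → Carrier → Carrier → Carrier) :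
                  Set (c ⊔ ℓ₁ ⊔ ℓ₂) where
    field
      program : Program 1 2

    start : ℕ → Carrier → Carrier →
            Config (2 ℕ.+ Program.workℕ program) (2 ℕ.+ Program.workˢ program)
    start n ε δ = initial program (n Vec.∷ Vec.[]) (ε Vec.∷ δ Vec.∷ Vec.[])

    field
      correct : ∀ n .{{_ : NonZero n}} ε δ → 0# < ε → 0# < δ → δ < 1# →
        Σ[ N ∈ ℕ ]
          ( ι N ≤ T n ε δ
          × HaltsWithin 2 n N (start n ε δ)
          × (∀ (p q : Vector Carrier n) → IsDistribution p → IsDistribution q →
               (∥ p ⊖ q ∥₁ ≤ f ε →
                  1# - δ ≤ prob (samples p q) N true (start n ε δ))
             × (ε < ∥ p ⊖ q ∥₁ →
                  1# - δ ≤ prob (samples p q) N false (start n ε δ))))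

module Submission where

-- The test compares the endpoint of a t-step walk from each state u ≠ 0 with
-- the endpoint of one from state 0, running the given tester with parameters ε
-- and δ/n on these pairs of distributions, and accepts if every run accepts.
-- If M is (f(ε)/2, t)-mixing, then by the triangle inequality any two endpoint
-- distributions are within f(ε), so each of the n - 1 runs accepts with
-- probability at least 1 - δ/n, and all of them do with probability at least
-- 1 - (n - 1)δ/n > 1 - δ.  If M is not (ε, t)-mixing, then the distribution from
-- state 0 does not witness mixing, so the one from some state u is at distance
-- more than ε from it; here u ≠ 0, hence n ≥ 2, and the run for u accepts with
-- probability at most δ/n < δ.
--
-- The probabilistic part of this is the module Analysis.  The rest of the work
-- is to realize the test as a program that performs a run of the tester in
-- O(t) times the running time of the tester.  Its code contains a translation
-- of the code of the tester in which registers are renumbered and a query is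
-- replaced by a loop that walks t steps.  Each run must find its memory empty,
-- and clearing the memory is avoided by giving each run memory of its own:
-- the run for u keeps the content of address y at address y n + u.  Address 0
-- is left over, since there is no run for state 0, and serves as scratch space.
--
-- The correctness of the program is expressed by lower bounds on the
-- probability of a given answer (Reaches).  An upper bound on the probability
-- of acceptance is a lower bound on that of rejection, as the two add up to 1
-- for programs that always halt (prob-total).  The lemma simulate bounds the
-- probability for the translated tester followed by other code by the
-- expectation, over the answer of the tester, of the bounds for that code;
-- reaches-loop iterates this over all u.

open import Defs
import Algebra.Properties.AbelianGroup
import Algebra.Properties.Ring
import Algebra.Properties.Semiring.Mult
import Algebra.Properties.Semiring.Sum
import Algebra.Solver.Ring.NaturalCoefficients.Default
open import Data.Bool.Base using (Bool; true; false; if_then_else_)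
import Data.Bool.Properties as Bool
open import Data.Empty using (⊥)
open import Data.Fin.Base using (Fin; zero; suc; toℕ; fromℕ<; _↑ʳ_)
open import Data.Fin.Patterns
import Data.Fin.Properties as Fin
open import Data.List.Base as List using (List; []; _∷_; _++_; length; allFin; foldl)
open import Data.List.Membership.Propositional using (_∈_)
open import Data.List.Membership.Propositional.Properties using (∈-allFin)
import Data.List.Properties as List
open import Data.List.Relation.Unary.Any using (here; there)
open import Data.Nat.Base as ℕ using (ℕ; zero; suc; NonZero)
open import Data.Nat.DivMod using (_%_; [m+kn]%n≡m%n; m<n⇒m%n≡m)
import Data.Nat.Properties as ℕ
open import Data.Nat.Solver using (module +-*-Solver)
open import Data.Product.Base using (Σ-syntax; ∃-syntax; _×_; _,_; proj₁; proj₂)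
open import Data.Sum.Base using (_⊎_; inj₁; inj₂)
open import Data.Unit.Base using (tt)
open import Data.Vec.Base as Vec using (Vec; []; _∷_; lookup; _[_]≔_)
open import Data.Vec.Functional using (Vector)
import Data.Vec.Properties as Vec
open import Level using (Lift; _⊔_)
open import Relation.Binary.Bundles using (Poset)
import Relation.Binary.Construct.NonStrictToStrict
open import Relation.Binary.Definitions using (tri<; tri≈; tri>)
open import Relation.Binary.PropositionalEquality as ≡ using (_≡_; _≢_)
import Relation.Binary.Reasoning.PartialOrder
open import Relation.Binary.Structures using (IsDecTotalOrder)
open import Relation.Nullary.Decidable
  using (yes; no; does; True; toWitness; dec-true; dec-false)
open import Relation.Nullary.Negation.Core using (¬_; contradiction)

----------------------------------------------------------------------
-- Ordered fields

module OrderedFieldProperties {c ℓ₁ ℓ₂} (F : OrderedField c ℓ₁ ℓ₂) where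
  open OrderedField F
  open IsDecTotalOrder isDecTotalOrder public
    using (isPartialOrder; total; antisym; ≤-respˡ-≈; ≤-respʳ-≈)
    renaming (refl to ≤-refl; reflexive to ≤-reflexive; trans to ≤-trans)
  open Algebra.Properties.Ring ring public
    using (-‿distribˡ-*; x[y-z]≈xy-xz)
  open Algebra.Properties.AbelianGroup +-abelianGroup public
    using (⁻¹-∙-comm; ⁻¹-anti-homo‿-; ⁻¹-involutive; ε⁻¹≈ε)
  open Algebra.Properties.Semiring.Mult semiring using (×1-homo-*)
  open Algebra.Properties.Semiring.Sum semiring public
    using (sum-cong-≋; ∑-distrib-+; ∑-comm; *-distribˡ-sum; *-distribʳ-sum;
           sum-replicate; sum-replicate-zero)
  open Relation.Binary.Construct.NonStrictToStrict _≈_ _≤_ public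
    using (<⇒≤)
  private
    module Strict = Relation.Binary.Construct.NonStrictToStrict _≈_ _≤_

  poset : Poset c ℓ₁ ℓ₂
  poset = record { isPartialOrder = isPartialOrder }

  module ≤-Reasoning = Relation.Binary.Reasoning.PartialOrder poset
  open ≤-Reasoning

  module Solver = Algebra.Solver.Ring.NaturalCoefficients.Default commutativeSemiring
  open Solver using (solve; _:+_; _:*_; _:=_)

  ≰⇒> : ∀ {x y} → ¬ (x ≤ y) → y < x
  ≰⇒> = Strict.≰⇒> sym ≤-reflexive total

  -- Addition and subtraction

  +-monoˡ-≤ : ∀ x {y z} → y ≤ z → y + x ≤ z + x
  +-monoˡ-≤ x {y} {z} y≤z = begin
    y + x ≈⟨ +-comm y x ⟩
    x + y ≤⟨ +-monoʳ-≤ x y≤z ⟩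
    x + z ≈⟨ +-comm x z ⟩
    z + x ∎

  +-mono-≤ : ∀ {w x y z} → w ≤ x → y ≤ z → w + y ≤ x + z
  +-mono-≤ {w} {x} {y} {z} w≤x y≤z = ≤-trans (+-monoˡ-≤ y w≤x) (+-monoʳ-≤ x y≤z)

  x+y-y≈x : ∀ x y → (x + y) - y ≈ x
  x+y-y≈x x y = begin-equality
    (x + y) - y ≈⟨ +-assoc x y (- y) ⟩
    x + (y - y) ≈⟨ +-congˡ (-‿inverseʳ y) ⟩
    x + 0#      ≈⟨ +-identityʳ x ⟩
    x           ∎

  x-y+y≈x : ∀ x y → (x - y) + y ≈ x
  x-y+y≈x x y = begin-equality
    (x - y) + y   ≈⟨ +-assoc x (- y) y ⟩
    x + (- y + y) ≈⟨ +-congˡ (-‿inverseˡ y) ⟩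
    x + 0#        ≈⟨ +-identityʳ x ⟩
    x             ∎

  x+y≤z⇒x≤z-y : ∀ {x y z} → x + y ≤ z → x ≤ z - y
  x+y≤z⇒x≤z-y {x} {y} {z} h = ≤-respˡ-≈ (x+y-y≈x x y) (+-monoˡ-≤ (- y) h)

  x≤z-y⇒x+y≤z : ∀ {x y z} → x ≤ z - y → x + y ≤ z
  x≤z-y⇒x+y≤z {x} {y} {z} h = ≤-respʳ-≈ (x-y+y≈x z y) (+-monoˡ-≤ y h)

  +-cancelʳ-≤ : ∀ x {y z} → y + x ≤ z + x → y ≤ z
  +-cancelʳ-≤ x {y} {z} h = ≤-respʳ-≈ (x+y-y≈x z x) (x+y≤z⇒x≤z-y h)

  0≤y⇒x≤x+y : ∀ x {y} → 0# ≤ y → x ≤ x + y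
  0≤y⇒x≤x+y x 0≤y = ≤-respˡ-≈ (+-identityʳ x) (+-monoʳ-≤ x 0≤y)

  0<y⇒x<x+y : ∀ x {y} → 0# < y → x < x + y
  0<y⇒x<x+y x {y} (0≤y , 0≉y) = 0≤y⇒x≤x+y x 0≤y , λ x≈x+y → 0≉y (begin-equality
    0#          ≈⟨ -‿inverseʳ x ⟨
    x - x       ≈⟨ +-congʳ x≈x+y ⟩
    (x + y) - x ≈⟨ +-congʳ (+-comm x y) ⟩
    (y + x) - x ≈⟨ x+y-y≈x y x ⟩
    y           ∎)

  x≤y⇒0≤y-x : ∀ {x y} → x ≤ y → 0# ≤ y - x
  x≤y⇒0≤y-x {x} x≤y = x+y≤z⇒x≤z-y (≤-respˡ-≈ (sym (+-identityˡ x)) x≤y)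

  0≤y-x⇒x≤y : ∀ {x y} → 0# ≤ y - x → x ≤ y
  0≤y-x⇒x≤y {x} h = ≤-respˡ-≈ (+-identityˡ x) (x≤z-y⇒x+y≤z h)

  x≤0⇒0≤-x : ∀ {x} → x ≤ 0# → 0# ≤ - x
  x≤0⇒0≤-x {x} x≤0 = ≤-respʳ-≈ (+-identityˡ (- x)) (x≤y⇒0≤y-x x≤0)

  -‿mono-≤ : ∀ {x y} → x ≤ y → - y ≤ - x
  -‿mono-≤ {x} {y} x≤y = ≤-respˡ-≈ (+-identityˡ (- y)) (≤-respʳ-≈ lemma
    (+-monoˡ-≤ (- y) (x≤y⇒0≤y-x x≤y)))
    where
    lemma : (y - x) - y ≈ - x
    lemma = trans (+-congʳ (+-comm y (- x))) (x+y-y≈x (- x) y)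

  x-[y+z]≈[x-y]-z : ∀ x y z → x - (y + z) ≈ (x - y) - z
  x-[y+z]≈[x-y]-z x y z =
    trans (+-congˡ (sym (⁻¹-∙-comm y z))) (sym (+-assoc x (- y) (- z)))

  -- Multiplication

  *-monoˡ-≤ : ∀ {x y z} → 0# ≤ x → y ≤ z → x * y ≤ x * z
  *-monoˡ-≤ {x} {y} {z} 0≤x y≤z = 0≤y-x⇒x≤y (≤-respʳ-≈ (x[y-z]≈xy-xz x z y)
    (*-nonNegative 0≤x (x≤y⇒0≤y-x y≤z)))

  *-monoʳ-≤ : ∀ {x y z} → 0# ≤ x → y ≤ z → y * x ≤ z * x
  *-monoʳ-≤ {x} {y} {z} 0≤x y≤z =
    ≤-respˡ-≈ (*-comm x y) (≤-respʳ-≈ (*-comm x z) (*-monoˡ-≤ 0≤x y≤z))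

  -- If 1 ≤ 0, then 1 is a square of the nonnegative number -1.
  0≤1 : 0# ≤ 1#
  0≤1 with total 0# 1#
  ... | inj₁ 0≤1 = 0≤1
  ... | inj₂ 1≤0 = ≤-respʳ-≈ (begin-equality
    - 1# * - 1#   ≈⟨ -‿distribˡ-* 1# (- 1#) ⟨
    - (1# * - 1#) ≈⟨ -‿cong (*-identityˡ (- 1#)) ⟩
    - (- 1#)      ≈⟨ ⁻¹-involutive 1# ⟩
    1#            ∎) (*-nonNegative (x≤0⇒0≤-x 1≤0) (x≤0⇒0≤-x 1≤0))

  -- Natural numbers as scalars

  ι-homo-* : ∀ k l → ι (k ℕ.* l) ≈ ι k * ι l
  ι-homo-* = ×1-homo-*

  0≤ι : ∀ k → 0# ≤ ι k
  0≤ι zero    = ≤-refl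
  0≤ι (suc k) = ≤-trans 0≤1 (0≤y⇒x≤x+y 1# (0≤ι k))

  ι-mono-≤ : ∀ {k l} → k ℕ.≤ l → ι k ≤ ι l
  ι-mono-≤ {l = l} ℕ.z≤n   = 0≤ι l
  ι-mono-≤ (ℕ.s≤s k≤l) = +-monoʳ-≤ 1# (ι-mono-≤ k≤l)

  ι-suc≉0 : ∀ k → ¬ (ι (suc k) ≈ 0#)
  ι-suc≉0 k ι≈0 = 0≉1 (antisym 0≤1 (≤-respʳ-≈ ι≈0 (0≤y⇒x≤x+y 1# (0≤ι k))))

  -- Division by nonzero natural numbers

  0≤⁻¹ : ∀ {x} → 0# ≤ x → ¬ (x ≈ 0#) → 0# ≤ x ⁻¹
  0≤⁻¹ {x} 0≤x x≉0 with total 0# (x ⁻¹)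
  ... | inj₁ 0≤x⁻¹ = 0≤x⁻¹
  ... | inj₂ x⁻¹≤0 = contradiction (antisym 0≤1 1≤0) 0≉1
    where
    1≤0 : 1# ≤ 0#
    1≤0 = begin
      1#       ≈⟨ *-inverseʳ x≉0 ⟨
      x * x ⁻¹ ≤⟨ *-monoˡ-≤ 0≤x x⁻¹≤0 ⟩
      x * 0#   ≈⟨ zeroʳ x ⟩
      0#       ∎

  0≤÷ι : ∀ {x} k → 0# ≤ x → 0# ≤ x ÷ ι (suc k)
  0≤÷ι k 0≤x = *-nonNegative 0≤x (0≤⁻¹ (0≤ι (suc k)) (ι-suc≉0 k))

  ι*[x÷ι]≈x : ∀ k x → ι (suc k) * (x ÷ ι (suc k)) ≈ x
  ι*[x÷ι]≈x k x = begin-equality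
    ι (suc k) * (x * ι (suc k) ⁻¹)
      ≈⟨ solve 3 (λ a b c → a :* (b :* c) := b :* (a :* c)) refl _ _ _ ⟩
    x * (ι (suc k) * ι (suc k) ⁻¹) ≈⟨ *-congˡ (*-inverseʳ (ι-suc≉0 k)) ⟩
    x * 1#                         ≈⟨ *-identityʳ x ⟩
    x                              ∎

  ι-suc-* : ∀ k x → ι (suc k) * x ≈ x + ι k * x
  ι-suc-* k x = trans (distribʳ x 1# (ι k)) (+-congʳ (*-identityˡ x))

  x≈x÷ι+k*[x÷ι] : ∀ k x → x ≈ x ÷ ι (suc k) + ι k * (x ÷ ι (suc k))
  x≈x÷ι+k*[x÷ι] k x = trans (sym (ι*[x÷ι]≈x k x)) (ι-suc-* k _)

  0<÷ι : ∀ {x} k → 0# < x → 0# < x ÷ ι (suc k)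
  0<÷ι {x} k (0≤x , 0≉x) = 0≤÷ι k 0≤x , λ 0≈x÷ι → 0≉x (begin-equality
    0#                          ≈⟨ zeroʳ (ι (suc k)) ⟨
    ι (suc k) * 0#              ≈⟨ *-congˡ 0≈x÷ι ⟩
    ι (suc k) * (x ÷ ι (suc k)) ≈⟨ ι*[x÷ι]≈x k x ⟩
    x                           ∎)

  ÷ι<1 : ∀ {x} k → 0# < x → x < 1# → x ÷ ι (suc k) < 1#
  ÷ι<1 {x} k 0<x x<1 = begin-strict
    x ÷ ι (suc k)                       ≤⟨ 0≤y⇒x≤x+y _ (*-nonNegative (0≤ι k) (0≤÷ι k (<⇒≤ 0<x))) ⟩
    x ÷ ι (suc k) + ι k * (x ÷ ι (suc k)) ≈⟨ x≈x÷ι+k*[x÷ι] k x ⟨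
    x                                   <⟨ x<1 ⟩
    1#                                  ∎

  x÷2+x÷2≈x : ∀ x → x ÷ ι 2 + x ÷ ι 2 ≈ x
  x÷2+x÷2≈x x = trans
    (sym (trans (distribʳ _ 1# (ι 1)) (+-cong (*-identityˡ _)
      (trans (*-congʳ (+-identityʳ 1#)) (*-identityˡ _)))))
    (ι*[x÷ι]≈x 1 x)

  -- Sums

  sum-linear : ∀ {k} (y z : Vector Carrier k) α β →
    sum (λ i → y i * α + z i * β) ≈ sum y * α + sum z * β
  sum-linear y z α β = trans (∑-distrib-+ (λ i → y i * α) _)
    (sym (+-cong (*-distribʳ-sum α y) (*-distribʳ-sum β z)))

  sum-mono-≤ : ∀ {n} {v w : Vector Carrier n} → (∀ i → v i ≤ w i) → sum v ≤ sum w
  sum-mono-≤ {zero}  v≤w = ≤-refl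
  sum-mono-≤ {suc n} v≤w = +-mono-≤ (v≤w zero) (sum-mono-≤ (λ i → v≤w (suc i)))

  sum-nonNegative : ∀ {n} {v : Vector Carrier n} → (∀ i → 0# ≤ v i) → 0# ≤ sum v
  sum-nonNegative {n} 0≤v = ≤-respˡ-≈ (sum-replicate-zero n) (sum-mono-≤ 0≤v)

  -- Absolute values

  ∣∣-lub : ∀ {x y} → x ≤ y → - x ≤ y → ∣ x ∣ ≤ y
  ∣∣-lub {x} x≤y -x≤y with does (0# ≤? x)
  ... | true  = x≤y
  ... | false = -x≤y

  x≤∣x∣ : ∀ x → x ≤ ∣ x ∣
  x≤∣x∣ x with 0# ≤? x
  ... | yes 0≤x = ≤-refl
  ... | no  0≰x = let x≤0 = <⇒≤ (≰⇒> 0≰x) in ≤-trans x≤0 (x≤0⇒0≤-x x≤0)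

  -x≤∣x∣ : ∀ x → - x ≤ ∣ x ∣
  -x≤∣x∣ x with 0# ≤? x
  ... | yes 0≤x = ≤-trans (≤-respʳ-≈ ε⁻¹≈ε (-‿mono-≤ 0≤x)) 0≤x
  ... | no  0≰x = ≤-refl

  ∣x-x∣≤0 : ∀ x → ∣ x - x ∣ ≤ 0#
  ∣x-x∣≤0 x = ∣∣-lub (≤-reflexive (-‿inverseʳ x))
    (≤-reflexive (trans (-‿cong (-‿inverseʳ x)) ε⁻¹≈ε))

  [x-z]-[y-z]≈x-y : ∀ x y z → (x - z) - (y - z) ≈ x - y
  [x-z]-[y-z]≈x-y x y z = begin-equality
    (x - z) - (y - z) ≈⟨ +-congˡ (⁻¹-anti-homo‿- y z) ⟩
    (x - z) + (z - y) ≈⟨ +-assoc (x - z) z (- y) ⟨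
    (x - z) + z - y   ≈⟨ +-congʳ (x-y+y≈x x z) ⟩
    x - y             ∎

  ∣x-y∣≤∣x-z∣+∣y-z∣ : ∀ x y z → ∣ x - y ∣ ≤ ∣ x - z ∣ + ∣ y - z ∣
  ∣x-y∣≤∣x-z∣+∣y-z∣ x y z = ∣∣-lub
    (begin
      x - y                 ≈⟨ [x-z]-[y-z]≈x-y x y z ⟨
      (x - z) - (y - z)     ≤⟨ +-mono-≤ (x≤∣x∣ _) (-x≤∣x∣ _) ⟩
      ∣ x - z ∣ + ∣ y - z ∣ ∎)
    (begin
      - (x - y)             ≈⟨ ⁻¹-anti-homo‿- x y ⟩
      y - x                 ≈⟨ [x-z]-[y-z]≈x-y y x z ⟨
      (y - z) - (x - z)     ≤⟨ +-mono-≤ (x≤∣x∣ _) (-x≤∣x∣ _) ⟩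
      ∣ y - z ∣ + ∣ x - z ∣ ≈⟨ +-comm _ _ ⟩
      ∣ x - z ∣ + ∣ y - z ∣ ∎)

----------------------------------------------------------------------
-- Distributions and Markov chains

module ChainProperties {c ℓ₁ ℓ₂} (F : OrderedField c ℓ₁ ℓ₂) where
  open OrderedField F
  open Model F
  open OrderedFieldProperties F
  open ≤-Reasoning

  ⊖-triangle : ∀ {n} (p q s : Vector Carrier n) →
    ∥ p ⊖ q ∥₁ ≤ ∥ p ⊖ s ∥₁ + ∥ q ⊖ s ∥₁
  ⊖-triangle p q s = begin
    ∥ p ⊖ q ∥₁ ≤⟨ sum-mono-≤ (λ i → ∣x-y∣≤∣x-z∣+∣y-z∣ (p i) (q i) (s i)) ⟩
    sum (λ i → ∣ p i - s i ∣ + ∣ q i - s i ∣) ≈⟨ ∑-distrib-+ (λ i → ∣ p i - s i ∣) _ ⟩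
    ∥ p ⊖ s ∥₁ + ∥ q ⊖ s ∥₁ ∎

  ∥p⊖p∥≤0 : ∀ {n} (p : Vector Carrier n) → ∥ p ⊖ p ∥₁ ≤ 0#
  ∥p⊖p∥≤0 {n} p = ≤-respʳ-≈ (sum-replicate-zero n) (sum-mono-≤ (λ i → ∣x-x∣≤0 (p i)))

  ∣∣-mono-≈ : ∀ {x y} → x ≈ y → ∣ x ∣ ≤ ∣ y ∣
  ∣∣-mono-≈ {x} {y} x≈y = ∣∣-lub (≤-respˡ-≈ (sym x≈y) (x≤∣x∣ y))
    (≤-respˡ-≈ (-‿cong (sym x≈y)) (-x≤∣x∣ y))

  ⊖-mono-≈ : ∀ {n} {p q : Vector Carrier n} s → (∀ i → p i ≈ q i) →
    ∥ p ⊖ s ∥₁ ≤ ∥ q ⊖ s ∥₁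
  ⊖-mono-≈ s p≈q = sum-mono-≤ (λ i → ∣∣-mono-≈ (+-congʳ (p≈q i)))

  -- The mean of x under the point mass at u is x u.
  e-mean : ∀ {n} (u : Fin n) (x : Vector Carrier n) → sum (λ i → e u i * x i) ≈ x u
  e-mean {suc n} zero x = begin-equality
    1# * x zero + sum (λ i → 0# * x (suc i))
      ≈⟨ +-cong (*-identityˡ _)
           (trans (sum-cong-≋ (λ i → zeroˡ (x (suc i)))) (sum-replicate-zero n)) ⟩
    x zero + 0# ≈⟨ +-identityʳ _ ⟩
    x zero      ∎
  e-mean {suc n} (suc u) x = begin-equality
    0# * x zero + sum (λ i → e (suc u) (suc i) * x (suc i))
      ≈⟨ +-cong (zeroˡ _) (e-mean u (λ i → x (suc i))) ⟩
    0# + x (suc u)                              ≈⟨ +-identityˡ _ ⟩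
    x (suc u)                                   ∎

  e-isMarkovChain : ∀ {n} → IsMarkovChain (e {n})
  e-isMarkovChain u = nonNegative , (begin-equality
    sum (e u)                ≈⟨ sum-cong-≋ (λ i → *-identityʳ (e u i)) ⟨
    sum (λ i → e u i * 1#)   ≈⟨ e-mean u (λ _ → 1#) ⟩
    1#                       ∎)
    where
    nonNegative : ∀ i → 0# ≤ e u i
    nonNegative i with does (u Fin.≟ i)
    ... | true  = 0≤1
    ... | false = ≤-refl

  e-∙ : ∀ {m n} (u : Fin m) (A : Matrix m n) i → (e u ∙ A) i ≈ A u i
  e-∙ u A i = e-mean u (λ j → A j i)

  -- The law of total expectation: the mean of x after a step of A and then one
  -- of B is the mean, after a step of A, of its mean after a step of B.
  ⊗-mean : ∀ {l m n} (A : Matrix l m) (B : Matrix m n) u (x : Vector Carrier n) →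
    sum (λ v → (A ⊗ B) u v * x v) ≈ sum (λ w → A u w * sum (λ v → B w v * x v))
  ⊗-mean A B u x = begin-equality
    sum (λ v → sum (λ w → A u w * B w v) * x v)
      ≈⟨ sum-cong-≋ (λ v → trans (*-distribʳ-sum (x v) (λ w → A u w * B w v))
           (sum-cong-≋ (λ w → *-assoc (A u w) (B w v) (x v)))) ⟩
    sum (λ v → sum (λ w → A u w * (B w v * x v)))
      ≈⟨ ∑-comm (λ v w → A u w * (B w v * x v)) ⟩
    sum (λ w → sum (λ v → A u w * (B w v * x v)))
      ≈⟨ sum-cong-≋ (λ w → *-distribˡ-sum (A u w) (λ v → B w v * x v)) ⟨
    sum (λ w → A u w * sum (λ v → B w v * x v)) ∎

  -- A mean of ones.
  mean-1 : ∀ {n} {p : Vector Carrier n} → IsDistribution p →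
    ∀ {x : Vector Carrier n} → (∀ i → x i ≈ 1#) → sum (λ i → p i * x i) ≈ 1#
  mean-1 {p = p} (_ , sum-p) x≈1 =
    trans (sum-cong-≋ (λ i → trans (*-congˡ (x≈1 i)) (*-identityʳ (p i)))) sum-p

  ^-isMarkovChain : ∀ {n} {M : Matrix n n} → IsMarkovChain M →
    ∀ t → IsMarkovChain (M ^ t)
  ^-isMarkovChain Markov zero    = e-isMarkovChain
  ^-isMarkovChain {M = M} Markov (suc t) u =
    (λ v → sum-nonNegative (λ w →
       *-nonNegative (proj₁ (Markov u) w) (proj₁ (^-isMarkovChain Markov t w) v))) ,
    (begin-equality
      sum ((M ^ suc t) u)               ≈⟨ sum-cong-≋ (λ v → *-identityʳ ((M ^ suc t) u v)) ⟨
      sum (λ v → (M ^ suc t) u v * 1#)  ≈⟨ ⊗-mean M (M ^ t) u (λ _ → 1#) ⟩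
      sum (λ w → M u w * sum (λ v → (M ^ t) w v * 1#))
        ≈⟨ mean-1 (Markov u) (λ w → mean-1 (^-isMarkovChain Markov t w) (λ _ → refl)) ⟩
      1#                                ∎)

  samples-isDistribution : ∀ {n} {p q : Vector Carrier n} →
    IsDistribution p → IsDistribution q → ∀ i → IsDistribution (samples p q i)
  samples-isDistribution P Q zero       = P
  samples-isDistribution P Q (suc zero) = Q

----------------------------------------------------------------------
-- Expectations over runs of programs

module ExecutionProperties {c ℓ₁ ℓ₂} (F : OrderedField c ℓ₁ ℓ₂) where
  open OrderedField F
  open Model F
  open OrderedFieldProperties F
  open ChainProperties F
  open ≤-Reasoning
  open Solver using (solve; _:+_; _:*_; _:=_)

  -- The value on halting in the definition of the probability of an answer.
  indicator : Bool → Bool → Carrier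
  indicator answer accept = if does (accept Bool.≟ answer) then 1# else 0#

  -- The expected value of v at the answer of a run, where a run that does not
  -- halt within N steps contributes 0.
  value : ∀ {m n a b} → Matrix m n → (Bool → Carrier) → ℕ → Config (suc a) b → Carrier
  value O v zero    κ = 0#
  value O v (suc N) κ = expect O v (value O v N) (step κ)

  module _ {m n a b : ℕ} {O : Matrix m n} where

    expect-mono-≤ : (∀ q i → 0# ≤ O q i) → ∀ {h} {X Y : Config a b → Carrier} →
      (∀ κ → X κ ≤ Y κ) → ∀ s → expect O h X s ≤ expect O h Y s
    expect-mono-≤ 0≤O X≤Y (halt _)      = ≤-refl
    expect-mono-≤ 0≤O X≤Y (next κ)      = X≤Y κ
    expect-mono-≤ 0≤O X≤Y (uniform k f) =
      *-monoʳ-≤ (0≤⁻¹ (0≤ι (suc k)) (ι-suc≉0 k)) (sum-mono-≤ (λ i → X≤Y (f i)))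
    expect-mono-≤ 0≤O X≤Y (respond q f) =
      sum-mono-≤ (λ i → *-monoˡ-≤ (0≤O q i) (X≤Y (f i)))

    expect-nonNegative : (∀ q i → 0# ≤ O q i) → ∀ {h} {X : Config a b → Carrier} →
      (∀ b → 0# ≤ h b) → (∀ κ → 0# ≤ X κ) → ∀ s → 0# ≤ expect O h X s
    expect-nonNegative 0≤O 0≤h 0≤X (halt b)      = 0≤h b
    expect-nonNegative 0≤O 0≤h 0≤X (next κ)      = 0≤X κ
    expect-nonNegative 0≤O 0≤h 0≤X (uniform k f) = 0≤÷ι k (sum-nonNegative (λ i → 0≤X (f i)))
    expect-nonNegative 0≤O 0≤h 0≤X (respond q f) =
      sum-nonNegative (λ i → *-nonNegative (0≤O q i) (0≤X (f i)))

    expect-linear : ∀ {g h k} {X Y Z : Config a b → Carrier} {α β} →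
      (∀ b → g b ≈ h b * α + k b * β) → (∀ κ → X κ ≈ Y κ * α + Z κ * β) →
      ∀ s → expect O g X s ≈ expect O h Y s * α + expect O k Z s * β
    expect-linear g≈ X≈ (halt b)      = g≈ b
    expect-linear g≈ X≈ (next κ)      = X≈ κ
    expect-linear {X = X} {Y} {Z} {α} {β} g≈ X≈ (uniform k f) = begin-equality
      sum (λ i → X (f i)) * w
        ≈⟨ *-congʳ (sum-cong-≋ (λ i → X≈ (f i))) ⟩
      sum (λ i → Y (f i) * α + Z (f i) * β) * w
        ≈⟨ *-congʳ (sum-linear (λ i → Y (f i)) (λ i → Z (f i)) α β) ⟩
      (sum (λ i → Y (f i)) * α + sum (λ i → Z (f i)) * β) * w
        ≈⟨ solve 5 (λ y z a b w → (y :* a :+ z :* b) :* w := (y :* w) :* a :+ (z :* w) :* b)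
             refl _ _ α β w ⟩
      sum (λ i → Y (f i)) * w * α + sum (λ i → Z (f i)) * w * β ∎
      where w = ι (suc k) ⁻¹
    expect-linear {X = X} {Y} {Z} {α} {β} g≈ X≈ (respond q f) = begin-equality
      sum (λ i → O q i * X (f i))
        ≈⟨ sum-cong-≋ (λ i → trans (*-congˡ (X≈ (f i)))
             (solve 5 (λ y z a b w → w :* (y :* a :+ z :* b) := (w :* y) :* a :+ (w :* z) :* b)
                refl (Y (f i)) (Z (f i)) α β (O q i))) ⟩
      sum (λ i → O q i * Y (f i) * α + O q i * Z (f i) * β)
        ≈⟨ sum-linear (λ i → O q i * Y (f i)) (λ i → O q i * Z (f i)) α β ⟩
      sum (λ i → O q i * Y (f i)) * α + sum (λ i → O q i * Z (f i)) * β ∎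

  module _ {m n a b : ℕ} {O : Matrix m n} where

    -- Conditioning on the answer.
    value-linear : ∀ v N (κ : Config (suc a) b) →
      value O v N κ ≈ prob O N true κ * v true + prob O N false κ * v false
    value-linear v zero    κ = sym (trans (+-cong (zeroˡ _) (zeroˡ _)) (+-identityˡ 0#))
    value-linear v (suc N) κ = expect-linear halting (value-linear v N) (step κ)
      where
      halting : ∀ b → v b ≈ indicator true b * v true + indicator false b * v false
      halting true  = sym (trans (+-cong (*-identityˡ _) (zeroˡ _)) (+-identityʳ _))
      halting false = sym (trans (+-cong (zeroˡ _) (*-identityˡ _)) (+-identityˡ _))

    -- Together with value-linear, this says that the probabilities of the answers of
    -- a program that always halts add up to 1.
    value-1 : (∀ q → IsDistribution (O q)) → ∀ N (κ : Config (suc a) b) →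
      HaltsWithin m n N κ → value O (λ _ → 1#) N κ ≈ 1#
    value-1 stochastic (suc N) κ halts with step {m} {n} κ
    ... | halt _      = refl
    ... | next κ′     = value-1 stochastic N κ′ halts
    ... | uniform k f = trans
      (*-congʳ (trans (sum-cong-≋ (λ i → value-1 stochastic N (f i) (halts i)))
                      (sum-replicate (suc k))))
      (*-inverseʳ (ι-suc≉0 k))
    ... | respond q f =
      mean-1 (stochastic q) (λ i → value-1 stochastic N (f i) (halts i))

    prob-total : (∀ q → IsDistribution (O q)) → ∀ N (κ : Config (suc a) b) →
      HaltsWithin m n N κ → prob O N true κ + prob O N false κ ≈ 1#
    prob-total stochastic N κ halts = begin-equality
      prob O N true κ + prob O N false κ
        ≈⟨ +-cong (*-identityʳ _) (*-identityʳ _) ⟨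
      prob O N true κ * 1# + prob O N false κ * 1# ≈⟨ value-linear (λ _ → 1#) N κ ⟨
      value O (λ _ → 1#) N κ                       ≈⟨ value-1 stochastic N κ halts ⟩
      1#                                           ∎

    module _ (0≤O : ∀ q i → 0# ≤ O q i) (answer : Bool) where

      0≤indicator : ∀ accept → 0# ≤ indicator answer accept
      0≤indicator accept with does (accept Bool.≟ answer)
      ... | true  = 0≤1
      ... | false = ≤-refl

      prob-nonNegative : ∀ N (κ : Config (suc a) b) → 0# ≤ prob O N answer κ
      prob-nonNegative zero    κ = ≤-refl
      prob-nonNegative (suc N) κ =
        expect-nonNegative 0≤O 0≤indicator (prob-nonNegative N) (step κ)

      prob-mono-≤ : ∀ {N N′} → N ℕ.≤ N′ → ∀ (κ : Config (suc a) b) →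
        prob O N answer κ ≤ prob O N′ answer κ
      prob-mono-≤ {N′ = N′} ℕ.z≤n κ = prob-nonNegative N′ κ
      prob-mono-≤ (ℕ.s≤s N≤N′)    κ = expect-mono-≤ 0≤O (prob-mono-≤ N≤N′) (step κ)

  HaltsWithin⇒positive : ∀ {m n a b} N {κ : Config (suc a) b} →
    HaltsWithin m n N κ → 1 ℕ.≤ N
  HaltsWithin⇒positive (suc N) _ = ℕ.z<s

  HaltsWithin-mono-≤ : ∀ {m n a b N N′} → N ℕ.≤ N′ → {κ : Config (suc a) b} →
    HaltsWithin m n N κ → HaltsWithin m n N′ κ
  HaltsWithin-mono-≤ {m} {n} (ℕ.s≤s N≤N′) {κ} halts with step {m} {n} κ
  ... | halt _      = halts
  ... | next κ′     = HaltsWithin-mono-≤ N≤N′ halts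
  ... | uniform k f = λ i → HaltsWithin-mono-≤ N≤N′ (halts i)
  ... | respond q f = λ i → HaltsWithin-mono-≤ N≤N′ (halts i)

  -- Every run from κ halts within N steps, and the given answer has probability
  -- at least p.
  record Reaches {m n a b} (O : Matrix m n) (answer : Bool) (N : ℕ) (p : Carrier)
                 (κ : Config (suc a) b) : Set ℓ₂ where
    constructor reaches
    field
      halting     : HaltsWithin m n N κ
      probability : p ≤ prob O N answer κ
  open Reaches public

  -- The machine goes from κ to κ′ by k deterministic steps.  For concrete code this
  -- type computes to an equation between κ′ and the configuration reached, which
  -- usually holds by refl.
  Leads : ∀ {m n a b} → Matrix m n → ℕ → Config (suc a) b → Config (suc a) b → Set c
  LeadsAfter : ∀ {m n a b} → Matrix m n → ℕ → Step m n (suc a) b →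
    Config (suc a) b → Set c

  Leads O zero    κ κ′ = κ ≡ κ′
  Leads O (suc k) κ κ′ = LeadsAfter O k (step κ) κ′

  LeadsAfter O k (next κ) κ′ = Leads O k κ κ′
  LeadsAfter O k _        κ′ = Lift c ⊥

  after : ∀ {m n a b} {O : Matrix m n} {answer N p} {κ κ′ : Config (suc a) b} k →
    Leads O k κ κ′ → Reaches O answer N p κ′ → Reaches O answer (k ℕ.+ N) p κ
  after zero ≡.refl r = r
  after {m} {n} {O = O} {answer} {N} {p} {κ} (suc k) leads r
    with step {m} {n} κ in eq
  ... | next κ₁ = reaches
      (≡.subst (Always (HaltsWithin m n (k ℕ.+ N))) (≡.sym eq) (halting r₁))
      (≡.subst (λ s → p ≤ expect O (indicator answer) (prob O (k ℕ.+ N) answer) s)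
        (≡.sym eq) (probability r₁))
    where r₁ = after {O = O} k leads r

  weaken : ∀ {m n a b} {O : Matrix m n} → (∀ q → IsDistribution (O q)) →
    ∀ {answer N N′ p p′} {κ : Config (suc a) b} → N ℕ.≤ N′ → p′ ≤ p →
    Reaches O answer N p κ → Reaches O answer N′ p′ κ
  weaken stochastic {answer} {κ = κ} N≤N′ p′≤p r = reaches
    (HaltsWithin-mono-≤ N≤N′ (halting r))
    (≤-trans p′≤p (≤-trans (probability r)
      (prob-mono-≤ (λ q → proj₁ (stochastic q)) answer N≤N′ κ)))

----------------------------------------------------------------------
-- Translating the tester

-- The translation of programs with A natural-number and B scalar registers into
-- programs which have in front of these 9 and 3 registers of their own.
module Test (A B : ℕ) where

  -- The registers out, states and time are those of the output and of the inputs
  -- n and t.  The run with number k, held in the register run, is about the state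
  -- k, or is absent if k = 0; nil and one hold constants.  The scalar registers 0,
  -- 1 and 2 hold ε, δ and δ/n.
  out states time run nil one address clock walker : Fin (9 ℕ.+ A)
  out     = 0F
  states  = 1F
  time    = 2F
  run     = 3F
  nil     = 4F
  one     = 5F
  address = 6F
  clock   = 7F
  walker  = 8F

  -- The registers of the tester.

  register : Fin A → Fin (9 ℕ.+ A)
  register = 9 ↑ʳ_

  registerˢ : Fin B → Fin (3 ℕ.+ B)
  registerˢ = 3 ↑ʳ_

  Code : Set
  Code = List (Instr (9 ℕ.+ A) (3 ℕ.+ B))

  -- Puts the address that stands for the content of register y of the tester in the
  -- register address, and continues with K.
  locate : Fin A → Code → Code
  locate y K = op address mul (register y) states ∷ op address add address run ∷ K

  walkStep : Code
  walkStep = query walker walker ∷ op clock monus clock one ∷ []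

  -- Walks from the state in register s and puts the endpoint in register x of the
  -- tester.  Registers are copied by adding nil on the left, since 0 + x is x by
  -- definition.
  walkFrom : Fin (9 ℕ.+ A) → Fin A → Code
  walkFrom s x =
    op walker add nil s ∷ op clock add nil time ∷
    while clock walkStep ∷ op (register x) add nil walker ∷ []

  mutual
    translate : Instr A B → Code
    translate (const x k)    = const (register x) k ∷ []
    translate (op x ⊙ y z)   = op (register x) ⊙ (register y) (register z) ∷ []
    translate (load x y)     = locate y (load (register x) address ∷ [])
    translate (store x y)    = locate x (store address (register y) ∷ [])
    translate (cast r x)     = cast (registerˢ r) (register x) ∷ []
    translate (opˢ r ⊙ s u)  = opˢ (registerˢ r) ⊙ (registerˢ s) (registerˢ u) ∷ []
    translate (loadˢ r y)    = locate y (loadˢ (registerˢ r) address ∷ [])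
    translate (storeˢ x s)   = locate x (storeˢ address (registerˢ s) ∷ [])
    translate (leq x r s)    = leq (register x) (registerˢ r) (registerˢ s) ∷ []
    translate (rand x y)     = rand (register x) (register y) ∷ []
    -- Query 0 is a walk from k, query 1 one from 0; other queries have no effect.
    translate (query x y)    =
      branch (register y)
        (op walker monus (register y) one ∷ branch walker [] (walkFrom nil x) ∷ [])
        (walkFrom run x) ∷ []
    translate (branch x P Q) = branch (register x) (translates P) (translates Q) ∷ []
    translate (while x P)    = while (register x) (translates P) ∷ []

    translates : List (Instr A B) → Code
    translates []      = []
    translates (i ∷ K) = translate i ++ translates K

  -- A number of steps that suffices for simulating one step of the tester.
  overhead : ℕ → ℕ
  overhead t = 7 ℕ.+ t ℕ.* 3

  translates-++ : ∀ P K → translates (P ++ K) ≡ translates P ++ translates K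
  translates-++ []      K = ≡.refl
  translates-++ (i ∷ P) K = ≡.trans (≡.cong (translate i ++_) (translates-++ P K))
    (≡.sym (List.++-assoc (translate i) (translates P) (translates K)))

----------------------------------------------------------------------
-- Interleaved memories

-- The memory f, read at the addresses y n + k, is g.
Region : ∀ {ℓ} {X : Set ℓ} → ℕ → ℕ → (ℕ → X) → (ℕ → X) → Set ℓ
Region n k f g = ∀ y → f (y ℕ.* n ℕ.+ k) ≡ g y

-- Distinct regions are disjoint.
region-injective : ∀ {n k l} → k ℕ.< n → l ℕ.< n → ∀ {x y} →
  x ℕ.* n ℕ.+ k ≡ y ℕ.* n ℕ.+ l → k ≡ l
region-injective {suc n} {k} {l} k<n l<n {x} {y} eq = begin
  k                           ≡⟨ remainder k<n x ⟨
  (x ℕ.* suc n ℕ.+ k) % suc n ≡⟨ ≡.cong (_% suc n) eq ⟩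
  (y ℕ.* suc n ℕ.+ l) % suc n ≡⟨ remainder l<n y ⟩
  l                           ∎
  where
  open ≡.≡-Reasoning
  remainder : ∀ {k} → k ℕ.< suc n → ∀ x → (x ℕ.* suc n ℕ.+ k) % suc n ≡ k
  remainder {k} k<n x = ≡.trans
    (≡.cong (_% suc n) (ℕ.+-comm (x ℕ.* suc n) k))
    (≡.trans ([m+kn]%n≡m%n k x (suc n)) (m<n⇒m%n≡m k<n))

module _ {c ℓ₁ ℓ₂} (F : OrderedField c ℓ₁ ℓ₂) where
  open Model F using (_[_↦_])

  write-at : ∀ {ℓ} {X : Set ℓ} {f : ℕ → X} {x y v} → y ≡ x → (f [ x ↦ v ]) y ≡ v
  write-at {f = f} {x} {y} {v} y≡x =
    ≡.cong (if_then v else f y) (dec-true (y ℕ.≟ x) y≡x)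

  write-off : ∀ {ℓ} {X : Set ℓ} {f : ℕ → X} {x y v} → y ≢ x → (f [ x ↦ v ]) y ≡ f y
  write-off {f = f} {x} {y} {v} y≢x =
    ≡.cong (if_then v else f y) (dec-false (y ℕ.≟ x) y≢x)

  region-write : ∀ {ℓ} {X : Set ℓ} n .{{_ : NonZero n}} k (f g : ℕ → X) x v →
    Region n k f g → Region n k (f [ x ℕ.* n ℕ.+ k ↦ v ]) (g [ x ↦ v ])
  region-write n k f g x v f~g y with y ℕ.≟ x
  ... | yes y≡x = ≡.trans (write-at {f = f} (≡.cong (λ z → z ℕ.* n ℕ.+ k) y≡x))
    (≡.sym (write-at {f = g} y≡x))
  ... | no  y≢x = ≡.trans
    (write-off {f = f} (λ eq → y≢x (ℕ.*-cancelʳ-≡ y x n (ℕ.+-cancelʳ-≡ k _ _ eq))))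
    (≡.trans (f~g y) (≡.sym (write-off {f = g} y≢x)))

  region-frame : ∀ {ℓ} {X : Set ℓ} {n k l} → k ℕ.< n → l ℕ.< n → k ≢ l →
    ∀ (f : ℕ → X) {g} x {v} → Region n k f g → Region n k (f [ x ℕ.* n ℕ.+ l ↦ v ]) g
  region-frame k<n l<n k≢l f x f~g y = ≡.trans
    (write-off {f = f} (λ eq → k≢l (region-injective k<n l<n {y} {x} eq))) (f~g y)

----------------------------------------------------------------------
-- Simulation

module Simulation {c ℓ₁ ℓ₂} (F : OrderedField c ℓ₁ ℓ₂) (A B : ℕ) where
  open OrderedField F
  open Model F
  open OrderedFieldProperties F
  open ChainProperties F
  open ExecutionProperties F
  open Test (suc A) B
  open State

  module On (m : ℕ) (M : Matrix (suc m) (suc m)) (Markov : IsMarkovChain M)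
            (answer : Bool) (t : ℕ) (ε δ δ′ : Carrier) where

    n : ℕ
    n = suc m

    weaken′ : ∀ {a b N N′ p p′} {κ : Config (suc a) b} → N ℕ.≤ N′ → p′ ≤ p →
      Reaches M answer N p κ → Reaches M answer N′ p′ κ
    weaken′ = weaken Markov

    -- The state of the test in run k when the registers of the tester contain rs and
    -- ss; a, c and w are in address, clock and walker.  The output register
    -- contains 1 as long as no run has rejected.
    simulating : ℕ → ℕ → ℕ → ℕ → Vec ℕ (suc A) → Vec Carrier B →
      (ℕ → ℕ) → (ℕ → Carrier) → State (10 ℕ.+ A) (3 ℕ.+ B)
    simulating k a c w rs ss f fˢ = record
      { regs  = 1 ∷ n ∷ t ∷ k ∷ 0 ∷ 1 ∷ a ∷ c ∷ w ∷ rs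
      ; regsˢ = ε ∷ δ ∷ δ′ ∷ ss
      ; mem   = f
      ; memˢ  = fˢ
      }

    reaches-query : ∀ {a b N x y K} {σ : State (suc a) b} {X : Vector Carrier n} v →
      lookup (regs σ) y ≡ toℕ v →
      (∀ w → Reaches M answer N (X w) (K , σ ⟨ x ≔ toℕ w ⟩)) →
      Reaches M answer (suc N) (sum (λ w → M v w * X w)) (query x y ∷ K , σ)
    reaches-query {N = N} {x} {y} {K} {σ} {X} v eq r = reaches halts probable
      where
      halts : HaltsWithin n n (suc N) (query x y ∷ K , σ)
      halts rewrite eq with toℕ v ℕ.<? n
      ... | no  v≮n = contradiction (Fin.toℕ<n v) v≮n
      ... | yes v<n = λ w → halting (r w)
      probable : sum (λ w → M v w * X w) ≤ prob M (suc N) answer (query x y ∷ K , σ)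
      probable rewrite eq with toℕ v ℕ.<? n
      ... | no  v≮n = contradiction (Fin.toℕ<n v) v≮n
      ... | yes v<n rewrite Fin.fromℕ<-toℕ v v<n =
        sum-mono-≤ (λ w → *-monoˡ-≤ (proj₁ (Markov v) w) (probability (r w)))

    reaches-rand-zero : ∀ {a b N p x y K} {σ : State (suc a) b} →
      lookup (regs σ) y ≡ 0 → Reaches M answer N p (K , σ) →
      Reaches M answer (suc N) p (rand x y ∷ K , σ)
    reaches-rand-zero {N = N} {p} {x} {y} {K} {σ} eq r = reaches halts probable
      where
      halts : HaltsWithin n n (suc N) (rand x y ∷ K , σ)
      halts rewrite eq = halting r
      probable : p ≤ prob M (suc N) answer (rand x y ∷ K , σ)
      probable rewrite eq = probability r

    reaches-rand-suc : ∀ {a b N x y K k} {σ : State (suc a) b} {X : Vector Carrier (suc k)} →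
      lookup (regs σ) y ≡ suc k →
      (∀ i → Reaches M answer N (X i) (K , σ ⟨ x ≔ toℕ i ⟩)) →
      Reaches M answer (suc N) (sum X ÷ ι (suc k)) (rand x y ∷ K , σ)
    reaches-rand-suc {N = N} {x} {y} {K} {k} {σ} {X} eq r = reaches halts probable
      where
      halts : HaltsWithin n n (suc N) (rand x y ∷ K , σ)
      halts rewrite eq = λ i → halting (r i)
      probable : sum X ÷ ι (suc k) ≤ prob M (suc N) answer (rand x y ∷ K , σ)
      probable rewrite eq = *-monoʳ-≤ (0≤⁻¹ (0≤ι (suc k)) (ι-suc≉0 k))
        (sum-mono-≤ (λ i → probability (r i)))

    -- The last c steps of a walk, which is at v: the bound is the mean of X at the
    -- state after c steps from v.
    reaches-walk : ∀ {N k a rs ss f fˢ x K} {X : Vector Carrier n} c (v : Fin n) →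
      (∀ w → Reaches M answer N (X w)
        (K , simulating k a 0 (toℕ w) (rs [ x ]≔ toℕ w) ss f fˢ)) →
      Reaches M answer (2 ℕ.+ (c ℕ.* 3 ℕ.+ N)) (sum (λ w → (M ^ c) v w * X w))
        (while clock walkStep ∷ op (register x) add nil walker ∷ K ,
         simulating k a c (toℕ v) rs ss f fˢ)
    reaches-walk {X = X} zero v r =
      weaken′ ℕ.≤-refl (≤-reflexive (e-mean v X)) (after 2 ≡.refl (r v))
    reaches-walk {X = X} (suc c) v r =
      weaken′ ℕ.≤-refl (≤-reflexive (⊗-mean M (M ^ c) v X))
        (after 1 ≡.refl (reaches-query v ≡.refl
          (λ w → after 1 ≡.refl (reaches-walk c w r))))

    -- The memories f and fˢ of the test in run k, when the tester is in state σ.  The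
    -- regions of the runs to come, which are those with smaller numbers, are empty.
    record Tracks (k : ℕ) (σ : State (suc A) B) (f : ℕ → ℕ) (fˢ : ℕ → Carrier) :
                  Set c where
      field
        current  : Region n k f (mem σ)
        currentˢ : Region n k fˢ (memˢ σ)
        fresh    : ∀ l → 0 ℕ.< l → l ℕ.< k → Region n l f (λ _ → 0)
        freshˢ   : ∀ l → 0 ℕ.< l → l ℕ.< k → Region n l fˢ (λ _ → 0#)
    open Tracks

    tracks-store : ∀ {k σ f fˢ} → k ℕ.< n → ∀ x v → Tracks k σ f fˢ →
      Tracks k (record σ { mem = mem σ [ x ↦ v ] }) (f [ x ℕ.* n ℕ.+ k ↦ v ]) fˢ
    tracks-store {k} {σ} {f} k<n x v tracks = record
      { current  = region-write F n k f (mem σ) x v (current tracks)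
      ; currentˢ = currentˢ tracks
      ; fresh    = λ l 0<l l<k → region-frame F (ℕ.<-trans l<k k<n) k<n (ℕ.<⇒≢ l<k) f x
                     (fresh tracks l 0<l l<k)
      ; freshˢ   = freshˢ tracks
      }

    tracks-storeˢ : ∀ {k σ f fˢ} → k ℕ.< n → ∀ x v → Tracks k σ f fˢ →
      Tracks k (record σ { memˢ = memˢ σ [ x ↦ v ] }) f (fˢ [ x ℕ.* n ℕ.+ k ↦ v ])
    tracks-storeˢ {k} {σ} {fˢ = fˢ} k<n x v tracks = record
      { current  = current tracks
      ; currentˢ = region-write F n k fˢ (memˢ σ) x v (currentˢ tracks)
      ; fresh    = fresh tracks
      ; freshˢ   = λ l 0<l l<k → region-frame F (ℕ.<-trans l<k k<n) k<n (ℕ.<⇒≢ l<k) fˢ x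
                     (freshˢ tracks l 0<l l<k)
      }

    module _ (u : Fin n) where

      -- The oracle that the tester has in run u.
      endpoints : Matrix 2 n
      endpoints = samples ((M ^ t) u) ((M ^ t) zero)

      -- The code rest follows that of the tester; finish says that v accept is a lower
      -- bound when rest starts after the tester halted with answer accept.
      module _ {rest : Code} {N₀ : ℕ} {v : Bool → Carrier}
        (finish : ∀ σ a c w f fˢ → Tracks (toℕ u) σ f fˢ →
          Reaches M answer N₀ (v (nonzero (lookup (regs σ) zero)))
            (rest , simulating (toℕ u) a c w (regs σ) (regsˢ σ) f fˢ)) where

        -- The statement of the simulation for at most N steps of the tester.
        Simulated : ℕ → Config (suc A) B → Set (c ⊔ ℓ₂)
        Simulated N (K , σ) = ∀ a c w {f fˢ} → Tracks (toℕ u) σ f fˢ →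
          Reaches M answer (N ℕ.* overhead t ℕ.+ N₀) (value endpoints v N (K , σ))
            (translates K ++ rest , simulating (toℕ u) a c w (regs σ) (regsˢ σ) f fˢ)

        -- One more instruction of the tester pays for up to 7 + 3t steps.
        pay : ∀ {κ : Config (10 ℕ.+ A) (3 ℕ.+ B)} {p} N j {_ : True (j ℕ.≤? 7)} {d} →
          d ℕ.≤ t ℕ.* 3 → Reaches M answer (j ℕ.+ (d ℕ.+ (N ℕ.* overhead t ℕ.+ N₀))) p κ →
          Reaches M answer (suc N ℕ.* overhead t ℕ.+ N₀) p κ
        pay N j {j≤7} {d} d≤3t = weaken′ bound ≤-refl
          where
          open ℕ.≤-Reasoning
          bound : j ℕ.+ (d ℕ.+ (N ℕ.* overhead t ℕ.+ N₀)) ℕ.≤ suc N ℕ.* overhead t ℕ.+ N₀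
          bound = begin
            j ℕ.+ (d ℕ.+ (N ℕ.* overhead t ℕ.+ N₀))
              ≤⟨ ℕ.+-mono-≤ (toWitness j≤7) (ℕ.+-monoˡ-≤ _ d≤3t) ⟩
            7 ℕ.+ (t ℕ.* 3 ℕ.+ (N ℕ.* overhead t ℕ.+ N₀))
              ≡⟨ ℕ.+-assoc 7 (t ℕ.* 3) _ ⟨
            overhead t ℕ.+ (N ℕ.* overhead t ℕ.+ N₀)
              ≡⟨ ℕ.+-assoc (overhead t) (N ℕ.* overhead t) N₀ ⟨
            suc N ℕ.* overhead t ℕ.+ N₀ ∎

        payConstant : ∀ {κ : Config (10 ℕ.+ A) (3 ℕ.+ B)} {p} N j {_ : True (j ℕ.≤? 7)} →
          Reaches M answer (j ℕ.+ (N ℕ.* overhead t ℕ.+ N₀)) p κ →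
          Reaches M answer (suc N ℕ.* overhead t ℕ.+ N₀) p κ
        payConstant N j {j≤7} = pay N j {j≤7} ℕ.z≤n

        translates-++-++ : ∀ P K →
          translates P ++ (translates K ++ rest) ≡ translates (P ++ K) ++ rest
        translates-++-++ P K = ≡.sym (≡.trans
          (≡.cong (_++ rest) (translates-++ P K))
          (List.++-assoc (translates P) (translates K) rest))

        branch-code : ∀ b P Q K →
          (if b then translates P else translates Q) ++ (translates K ++ rest) ≡
          translates ((if b then P else Q) ++ K) ++ rest
        branch-code true  P Q K = translates-++-++ P K
        branch-code false P Q K = translates-++-++ Q K

        while-code : ∀ b x P K →
          (if b then translates P ++ (while (register x) (translates P) ∷ translates K ++ rest)
                else translates K ++ rest) ≡
          translates (if b then P ++ while x P ∷ K else K) ++ rest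
        while-code true  x P K = translates-++-++ P (while x P ∷ K)
        while-code false x P K = ≡.refl

        -- The configurations in the translation of a query, as functions of the query.

        queryBranch : ∀ x y K (σ : State (suc A) B) a c w {f fˢ} → ℕ → Config (10 ℕ.+ A) (3 ℕ.+ B)
        queryBranch x y K σ a c w {f} {fˢ} q =
          (if nonzero q
             then op walker monus (register y) one ∷ branch walker [] (walkFrom nil x) ∷ []
             else walkFrom run x) ++ translates K ++ rest ,
          simulating (toℕ u) a c w (regs σ) (regsˢ σ) f fˢ

        queryBranch₁ : ∀ x K (σ : State (suc A) B) a c {f fˢ} → ℕ → Config (10 ℕ.+ A) (3 ℕ.+ B)
        queryBranch₁ x K σ a c {f} {fˢ} q =
          branch walker [] (walkFrom nil x) ∷ translates K ++ rest ,
          simulating (toℕ u) a c (q ℕ.∸ 1) (regs σ) (regsˢ σ) f fˢ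

        -- By induction on the number of steps that the tester may still take.  The
        -- scalars in its registers are propositionally equal to the simulated ones, not
        -- just ≈, so that no program needs to be shown to respect ≈.
        simulate : ∀ N κ → HaltsWithin 2 n N κ → Simulated N κ
        simulate (suc N) ([] , σ) h a c w {f} {fˢ} tr =
          weaken′ (ℕ.m≤n+m N₀ (suc N ℕ.* overhead t)) ≤-refl (finish σ a c w _ _ tr)
        simulate (suc N) (const x k ∷ K , σ) h a c w {f} {fˢ} tr =
          payConstant N 1 (after 1 ≡.refl (simulate N _ h a c w (record { Tracks tr })))
        simulate (suc N) (op x ⊙ y z ∷ K , σ) h a c w {f} {fˢ} tr =
          payConstant N 1 (after 1 ≡.refl (simulate N _ h a c w (record { Tracks tr })))
        simulate (suc N) (load x y ∷ K , σ) h a c w {f} {fˢ} tr =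
          payConstant N 3 (after 3
            (≡.cong (λ z → translates K ++ rest ,
                simulating (toℕ u) (lookup (regs σ) y ℕ.* n ℕ.+ toℕ u) c w
                  (regs σ [ x ]≔ z) (regsˢ σ) f fˢ)
              (current tr (lookup (regs σ) y)))
            (simulate N _ h _ c w (record { Tracks tr })))
        simulate (suc N) (store x y ∷ K , σ) h a c w {f} {fˢ} tr =
          payConstant N 3 (after 3 ≡.refl (simulate N _ h _ c w
            (tracks-store (Fin.toℕ<n u) (lookup (regs σ) x) (lookup (regs σ) y) tr)))
        simulate (suc N) (cast r x ∷ K , σ) h a c w {f} {fˢ} tr =
          payConstant N 1 (after 1 ≡.refl (simulate N _ h a c w (record { Tracks tr })))
        simulate (suc N) (opˢ r ⊙ s s′ ∷ K , σ) h a c w {f} {fˢ} tr =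
          payConstant N 1 (after 1 ≡.refl (simulate N _ h a c w (record { Tracks tr })))
        simulate (suc N) (loadˢ r y ∷ K , σ) h a c w {f} {fˢ} tr =
          payConstant N 3 (after 3
            (≡.cong (λ z → translates K ++ rest ,
                simulating (toℕ u) (lookup (regs σ) y ℕ.* n ℕ.+ toℕ u) c w
                  (regs σ) (regsˢ σ [ r ]≔ z) f fˢ)
              (currentˢ tr (lookup (regs σ) y)))
            (simulate N _ h _ c w (record { Tracks tr })))
        simulate (suc N) (storeˢ x s ∷ K , σ) h a c w {f} {fˢ} tr =
          payConstant N 3 (after 3 ≡.refl (simulate N _ h _ c w
            (tracks-storeˢ (Fin.toℕ<n u) (lookup (regs σ) x) (lookup (regsˢ σ) s) tr)))
        simulate (suc N) (leq x r s ∷ K , σ) h a c w {f} {fˢ} tr =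
          payConstant N 1 (after 1 ≡.refl (simulate N _ h a c w (record { Tracks tr })))
        simulate (suc N) (rand x y ∷ K , σ) h a c w tr with lookup (regs σ) y in eq
        ... | zero  = payConstant N 1 (reaches-rand-zero eq
          (simulate N _ h a c w (record { Tracks tr })))
        ... | suc k = payConstant N 1 (reaches-rand-suc eq
          (λ i → simulate N _ (h i) a c w (record { Tracks tr })))
        simulate (suc N) (query x y ∷ K , σ) h a c w {f} {fˢ} tr
          with lookup (regs σ) y in eq
        ... | zero        = pay N 5 ℕ.≤-refl (after 1 (≡.cong (queryBranch x y K σ a c w) eq)
          (after 2 ≡.refl (reaches-walk t u (λ i →
            simulate N _ (h i) a 0 (toℕ i) (record { Tracks tr })))))
        ... | suc zero    = pay N 7 ℕ.≤-refl (after 1 (≡.cong (queryBranch x y K σ a c w) eq)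
          (after 1 (≡.cong (queryBranch₁ x K σ a c) eq)
          (after 3 ≡.refl (reaches-walk t zero (λ i →
            simulate N _ (h i) a 0 (toℕ i) (record { Tracks tr }))))))
        ... | suc (suc q) = payConstant N 3 (after 1 (≡.cong (queryBranch x y K σ a c w) eq)
          (after 1 (≡.cong (queryBranch₁ x K σ a c) eq)
          (after 1 ≡.refl (simulate N _ h a c (suc q) (record { Tracks tr })))))
        simulate (suc N) (branch x P Q ∷ K , σ) h a c w tr =
          payConstant N 1 (after 1 (≡.cong (_, simulating _ a c w (regs σ) (regsˢ σ) _ _)
            (branch-code (nonzero (lookup (regs σ) x)) P Q K))
            (simulate N _ h a c w (record { Tracks tr })))
        simulate (suc N) (while x P ∷ K , σ) h a c w tr =
          payConstant N 1 (after 1 (≡.cong (_, simulating _ a c w (regs σ) (regsˢ σ) _ _)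
            (while-code (nonzero (lookup (regs σ) x)) x P K))
            (simulate N _ h a c w (record { Tracks tr })))

----------------------------------------------------------------------
-- Filling vectors

module _ {ℓ} {X : Set ℓ} where

  -- Overwriting the entries with the listed indices by v.
  fill : ∀ {n} → X → Vec X n → List (Fin n) → Vec X n
  fill v = foldl (λ xs i → xs [ i ]≔ v)

  lookup-fill : ∀ {n} v (xs : Vec X n) is j → j ∈ is ⊎ lookup xs j ≡ v →
    lookup (fill v xs is) j ≡ v
  lookup-fill v xs []       j (inj₂ eq) = eq
  lookup-fill v xs (i ∷ is) j h = lookup-fill v (xs [ i ]≔ v) is j (next h)
    where
    next : j ∈ i ∷ is ⊎ lookup xs j ≡ v → j ∈ is ⊎ lookup (xs [ i ]≔ v) j ≡ v
    next (inj₁ (here ≡.refl)) = inj₂ (Vec.lookup∘updateAt j xs)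
    next (inj₁ (there j∈is))  = inj₁ j∈is
    next (inj₂ eq) with j Fin.≟ i
    ... | yes ≡.refl = inj₂ (Vec.lookup∘updateAt j xs)
    ... | no  j≢i    = inj₂ (≡.trans (Vec.lookup∘updateAt′ j i j≢i xs) eq)

  fill-all : ∀ {n} v (xs : Vec X n) → fill v xs (allFin n) ≡ Vec.replicate n v
  fill-all {n} v xs = begin
    filled                       ≡⟨ Vec.tabulate∘lookup filled ⟨
    Vec.tabulate (lookup filled)
      ≡⟨ Vec.tabulate-cong (λ i → ≡.trans
           (lookup-fill v xs (allFin n) i (inj₁ (∈-allFin i)))
           (≡.sym (Vec.lookup-replicate i v))) ⟩
    Vec.tabulate (lookup (Vec.replicate n v)) ≡⟨ Vec.tabulate∘lookup _ ⟩
    Vec.replicate n v            ∎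
    where
    open ≡.≡-Reasoning
    filled = fill v xs (allFin n)

----------------------------------------------------------------------
-- Running time

-- The difference of the two sides is a polynomial with nonnegative coefficients in
-- m, c, t - 1 and N - 1.
steps-arithmetic : ∀ c m {t N} → 1 ℕ.≤ t → 1 ℕ.≤ N →
  5 ℕ.+ (m ℕ.* (c ℕ.+ N ℕ.* (7 ℕ.+ t ℕ.* 3)) ℕ.+ 2) ℕ.≤
  (c ℕ.+ 17) ℕ.* (suc m ℕ.* t ℕ.* N)
steps-arithmetic c m {suc s} {suc r} _ _ = ℕ.m+n≤o⇒m≤o _ (ℕ.≤-reflexive
  (solve 4 (λ c m s r →
      (con 5 :+ (m :* (c :+ (con 1 :+ r) :* (con 7 :+ (con 1 :+ s) :* con 3)) :+ con 2)) :+
      (c :* (con 1 :+ s) :* (con 1 :+ r) :+ (con 10 :+ con 17 :* (s :+ r :+ s :* r)) :+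
       m :* c :* (s :+ r :+ s :* r) :+ m :* (con 1 :+ r) :* (con 7 :+ con 14 :* s)) :=
      (c :+ con 17) :* ((con 1 :+ m) :* (con 1 :+ s) :* (con 1 :+ r)))
    ≡.refl c m s r))
  where open +-*-Solver using (solve; con; _:+_; _:*_; _:=_)

----------------------------------------------------------------------
-- The program

module TestProgram (P : Program 1 2) where
  open Program P

  -- The tester has suc A natural-number and B scalar registers.
  A B : ℕ
  A = 1 ℕ.+ workℕ
  B = 2 ℕ.+ workˢ
  open Test (suc A) B

  clear : List (Fin (suc A)) → Code
  clear = List.map (λ x → const (register x) 0)

  clearˢ : List (Fin B) → Code
  clearˢ = List.map (λ r → cast (registerˢ r) nil)

  -- Loads the inputs n, ε and δ/n of the tester.  Scalars are copied through the
  -- memory cell 0, which is not part of any run: adding 0 would only give a scalar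
  -- that is ≈ to the original.
  inputs : Code
  inputs =
    op (register 1F) add nil states ∷
    storeˢ nil 0F ∷ loadˢ (registerˢ 0F) nil ∷
    storeˢ nil 2F ∷ loadˢ (registerˢ 1F) nil ∷ []

  -- After acceptance the next run is that with the preceding number; after
  -- rejection the number 0 ends the loop.
  verdict : Code
  verdict = branch (register 0F)
    (op run monus run one ∷ [])
    (const run 0 ∷ const out 0 ∷ []) ∷ []

  body : Code
  body = clear (allFin (suc A)) ++ clearˢ (allFin B) ++ inputs ++
    translates code ++ verdict

  body-++ : ∀ K → body ++ K ≡
    clear (allFin (suc A)) ++ clearˢ (allFin B) ++ inputs ++
      translates code ++ verdict ++ K
  body-++ K = ≡.trans (List.++-assoc (clear (allFin (suc A))) _ K)
    (≡.cong (clear (allFin (suc A)) ++_)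
      (≡.trans (List.++-assoc (clearˢ (allFin B)) _ K)
        (≡.cong (λ L → clearˢ (allFin B) ++ inputs ++ L)
          (List.++-assoc (translates code) verdict K))))

  -- The runs have the numbers n - 1, …, 1, in this order.
  test : Program 2 2
  test = record
    { workℕ = 6 ℕ.+ suc A
    ; workˢ = 1 ℕ.+ B
    ; code  =
        const one 1 ∷ const out 1 ∷ op run monus states one ∷
        cast 2F states ∷ opˢ 2F div 1F 2F ∷ while run body ∷ []
    }

  -- A bound on the number of steps in an iteration of the loop outside of the
  -- translated code.
  overheads : ℕ
  overheads = length (allFin (suc A)) ℕ.+ (length (allFin B) ℕ.+ 9)

  module _ (t N : ℕ) where

    -- A bound on the time of the loop when k runs are to be done and the tester
    -- takes at most N steps.
    loopTime : ℕ → ℕ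
    loopTime zero    = 2
    loopTime (suc k) = 1 ℕ.+ (length (allFin (suc A)) ℕ.+ (length (allFin B) ℕ.+
      (5 ℕ.+ (N ℕ.* overhead t ℕ.+ (3 ℕ.+ loopTime k)))))

    loopTime≡ : ∀ k → loopTime k ≡ k ℕ.* (overheads ℕ.+ N ℕ.* overhead t) ℕ.+ 2
    loopTime≡ zero    = ≡.refl
    loopTime≡ (suc k) = ≡.trans
      (≡.cong (λ l → 1 ℕ.+ (length (allFin (suc A)) ℕ.+ (length (allFin B) ℕ.+
        (5 ℕ.+ (N ℕ.* overhead t ℕ.+ (3 ℕ.+ l)))))) (loopTime≡ k))
      (solve 4 (λ a b x y →
          con 1 :+ (a :+ (b :+ (con 5 :+ (x :+ (con 3 :+ (y :+ con 2)))))) :=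
          ((a :+ (b :+ con 9)) :+ x) :+ y :+ con 2) ≡.refl
        (length (allFin (suc A))) (length (allFin B)) (N ℕ.* overhead t)
        (k ℕ.* (overheads ℕ.+ N ℕ.* overhead t)))
      where open +-*-Solver using (solve; con; _:+_; _:=_)

    2≤loopTime : ∀ k → 2 ℕ.≤ loopTime k
    2≤loopTime k = ℕ.≤-trans (ℕ.m≤n+m 2 _) (ℕ.≤-reflexive (≡.sym (loopTime≡ k)))

    testTime : ℕ → ℕ
    testTime m = 5 ℕ.+ loopTime m

    -- The constant 17 is 7 for the steps outside of the iterations plus 10, since
    -- overhead t is at most 10 t.
    testTime-bound : ∀ m → 1 ℕ.≤ t → 1 ℕ.≤ N →
      testTime m ℕ.≤ (overheads ℕ.+ 17) ℕ.* (suc m ℕ.* t ℕ.* N)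
    testTime-bound m 1≤t 1≤N = ℕ.≤-trans
      (ℕ.≤-reflexive (≡.cong (5 ℕ.+_) (loopTime≡ m)))
      (steps-arithmetic overheads m 1≤t 1≤N)

----------------------------------------------------------------------
-- Executing the program

module Running {c ℓ₁ ℓ₂} (F : OrderedField c ℓ₁ ℓ₂) (P : Program 1 2) where
  open OrderedField F
  open Model F
  open OrderedFieldProperties F
  open ChainProperties F
  open ExecutionProperties F
  open TestProgram P
  open Test (suc A) B
  open State

  module On (m : ℕ) (M : Matrix (suc m) (suc m)) (Markov : IsMarkovChain M)
            (answer : Bool) (t : ℕ) (ε δ : Carrier) where

    open Simulation.On F A B m M Markov answer t ε δ (δ ÷ ι (suc m))

    δ′ : Carrier
    δ′ = δ ÷ ι n

    tester : Config (suc A) B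
    tester = initial P (n ∷ Vec.[]) (ε ∷ δ′ ∷ Vec.[])

    reaches-clear : ∀ {N p K k a c w ss f fˢ} xs rs →
      Reaches M answer N p (K , simulating k a c w (fill 0 rs xs) ss f fˢ) →
      Reaches M answer (length xs ℕ.+ N) p
        (clear xs ++ K , simulating k a c w rs ss f fˢ)
    reaches-clear []       rs r = r
    reaches-clear (x ∷ xs) rs r = after 1 ≡.refl (reaches-clear xs (rs [ x ]≔ 0) r)

    reaches-clearˢ : ∀ {N p K k a c w rs f fˢ} xs ss →
      Reaches M answer N p (K , simulating k a c w rs (fill 0# ss xs) f fˢ) →
      Reaches M answer (length xs ℕ.+ N) p
        (clearˢ xs ++ K , simulating k a c w rs ss f fˢ)
    reaches-clearˢ []       ss r = r
    reaches-clearˢ (x ∷ xs) ss r =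
      after 1 ≡.refl (reaches-clearˢ xs (ss [ x ]≔ 0#) r)

    reaches-clear-all : ∀ {N p K k a c w rs ss f fˢ} →
      Reaches M answer N p (K , simulating k a c w (Vec.replicate _ 0) ss f fˢ) →
      Reaches M answer (length (allFin (suc A)) ℕ.+ N) p
        (clear (allFin (suc A)) ++ K , simulating k a c w rs ss f fˢ)
    reaches-clear-all {N} {p} {K} {k} {a} {c} {w} {rs} {ss} {f} {fˢ} r =
      reaches-clear (allFin (suc A)) rs
        (≡.subst (λ rs → Reaches M answer N p (K , simulating k a c w rs ss f fˢ))
          (≡.sym (fill-all 0 rs)) r)

    reaches-clearˢ-all : ∀ {N p K k a c w rs ss f fˢ} →
      Reaches M answer N p (K , simulating k a c w rs (Vec.replicate _ 0#) f fˢ) →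
      Reaches M answer (length (allFin B) ℕ.+ N) p
        (clearˢ (allFin B) ++ K , simulating k a c w rs ss f fˢ)
    reaches-clearˢ-all {N} {p} {K} {k} {a} {c} {w} {rs} {ss} {f} {fˢ} r =
      reaches-clearˢ (allFin B) ss
        (≡.subst (λ ss → Reaches M answer N p (K , simulating k a c w rs ss f fˢ))
          (≡.sym (fill-all 0# ss)) r)

    -- The regions of the runs with positive numbers less than k contain v everywhere.
    Fresh : ∀ {ℓ} {X : Set ℓ} → ℕ → X → (ℕ → X) → Set ℓ
    Fresh k v f = ∀ l → 0 ℕ.< l → l ℕ.< k → Region n l f (λ _ → v)

    fresh-scratch : ∀ {ℓ} {X : Set ℓ} {k} {v : X} f → k ℕ.≤ n → ∀ w →
      Fresh k v f → Fresh k v (f [ 0 ↦ w ])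
    fresh-scratch f k≤n w fresh l 0<l l<k =
      region-frame F (ℕ.<-≤-trans l<k k≤n) ℕ.z<s (ℕ.>⇒≢ 0<l) f 0 (fresh l 0<l l<k)

    module _ (N : ℕ) (halts : HaltsWithin 2 n N tester) where

      -- The number b k bounds from below the probability of the answer when the loop is
      -- entered with run number k, and r bounds it after a rejection.
      -- The invariant is that b (suc k) is a lower bound if b k and r are after a run.
      module _ (b : ℕ → Carrier) (r : Carrier)
        (b₀≤ : b 0 ≤ indicator answer true) (r≤ : r ≤ indicator answer false)
        (invariant : ∀ (u : Fin n) k → toℕ u ≡ suc k →
          b (suc k) ≤ value (endpoints u) (λ accept → if accept then b k else r) N tester)
        where

        reaches-verdict : ∀ k {j a c w rs ss f fˢ} → j ≡ suc k →
          Reaches M answer (loopTime t N k) (b k)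
            (while run body ∷ [] , simulating k a c w rs ss f fˢ) →
          Reaches M answer (3 ℕ.+ loopTime t N k)
            (if nonzero (lookup rs zero) then b k else r)
            (verdict ++ while run body ∷ [] , simulating j a c w rs ss f fˢ)
        reaches-verdict k {j} {a} {c} {w} {rs} {ss} {f} {fˢ} j≡ loop
          with lookup rs zero in eq
        ... | suc _ = weaken′ (ℕ.n≤1+n _) ≤-refl (after 1
          (≡.cong (λ q → (if nonzero q then op run monus run one ∷ []
                                       else const run 0 ∷ const out 0 ∷ [])
                         ++ while run body ∷ [] , simulating j a c w rs ss f fˢ) eq)
          (after 1 (≡.cong (λ i → while run body ∷ [] ,
                                  simulating (i ℕ.∸ 1) a c w rs ss f fˢ) j≡) loop))
        ... | zero = weaken′ (ℕ.+-monoʳ-≤ 3 (2≤loopTime t N k)) ≤-refl (after 1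
          (≡.cong (λ q → (if nonzero q then op run monus run one ∷ []
                                       else const run 0 ∷ const out 0 ∷ [])
                         ++ while run body ∷ [] , simulating j a c w rs ss f fˢ) eq)
          (after 3 ≡.refl (reaches tt r≤)))

        reaches-loop : ∀ k → k ℕ.< n → ∀ {a c w rs ss f fˢ} →
          Fresh (suc k) 0 f → Fresh (suc k) 0# fˢ →
          Reaches M answer (loopTime t N k) (b k)
            (while run body ∷ [] , simulating k a c w rs ss f fˢ)
        reaches-loop zero    k<n _ _ = after 1 ≡.refl (reaches tt b₀≤)
        reaches-loop (suc k) k<n {a} {c} {w} {rs} {ss} {f} {fˢ} fresh freshˢ =
          ≡.subst (λ j → Reaches M answer (loopTime t N (suc k)) (b (suc k))
                    (while run body ∷ [] , simulating j a c w rs ss f fˢ))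
            u≡ (weaken′ ℕ.≤-refl (invariant u k u≡) start)
          where
          u : Fin n
          u = fromℕ< k<n

          u≡ : toℕ u ≡ suc k
          u≡ = Fin.toℕ-fromℕ< k<n

          finish : ∀ σ a c w f fˢ → Tracks (toℕ u) σ f fˢ →
            Reaches M answer (3 ℕ.+ loopTime t N k)
              (if nonzero (lookup (regs σ) zero) then b k else r)
              (verdict ++ while run body ∷ [] ,
               simulating (toℕ u) a c w (regs σ) (regsˢ σ) f fˢ)
          finish σ a c w f fˢ tracks = reaches-verdict k u≡
            (reaches-loop k (ℕ.<-trans (ℕ.n<1+n k) k<n)
              (≡.subst (λ j → Fresh j 0 f) u≡ (Tracks.fresh tracks))
              (≡.subst (λ j → Fresh j 0# fˢ) u≡ (Tracks.freshˢ tracks)))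

          earlier : ∀ {ℓ} {X : Set ℓ} {v : X} f →
            Fresh (suc (suc k)) v f → Fresh (toℕ u) v f
          earlier f fresh l 0<l l<u = fresh l 0<l (ℕ.<-trans l<u
            (≡.subst (ℕ._< suc (suc k)) (≡.sym u≡) ℕ.≤-refl))

          present : ∀ {ℓ} {X : Set ℓ} {v : X} f →
            Fresh (suc (suc k)) v f → Region n (toℕ u) f (λ _ → v)
          present f fresh = fresh (toℕ u) (≡.subst (0 ℕ.<_) (≡.sym u≡) ℕ.z<s)
            (≡.subst (ℕ._< suc (suc k)) (≡.sym u≡) ℕ.≤-refl)

          fˢ′ : ℕ → Carrier
          fˢ′ = (fˢ [ 0 ↦ ε ]) [ 0 ↦ δ′ ]

          freshˢ′ : Fresh (suc (suc k)) 0# fˢ′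
          freshˢ′ = fresh-scratch (fˢ [ 0 ↦ ε ]) k<n δ′ (fresh-scratch fˢ k<n ε freshˢ)

          start : Reaches M answer (loopTime t N (suc k))
                    (value (endpoints u) (λ accept → if accept then b k else r) N tester)
                    (while run body ∷ [] , simulating (toℕ u) a c w rs ss f fˢ)
          start = after 1
            (≡.cong (_, simulating (toℕ u) a c w rs ss f fˢ) (body-++ (while run body ∷ [])))
            (reaches-clear-all (reaches-clearˢ-all (after 5 ≡.refl
              (simulate u {v = λ accept → if accept then b k else r} finish
                N tester halts a c w {f} {fˢ′} (record
                  { current  = present f fresh
                  ; currentˢ = present fˢ′ freshˢ′
                  ; fresh    = earlier f fresh
                  ; freshˢ   = earlier fˢ′ freshˢ′
                  })))))

        reaches-test :
          Reaches M answer (testTime t N m) (b m)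
            (initial test (n ∷ t ∷ Vec.[]) (ε ∷ δ ∷ Vec.[]))
        reaches-test = after 5 ≡.refl (reaches-loop m ℕ.≤-refl
          (λ _ _ _ _ → ≡.refl) (λ _ _ _ _ → ≡.refl))

----------------------------------------------------------------------
-- The probability of acceptance

-- The tester and the test are arbitrary configurations here, of which only the
-- properties halts, testerCorrect and runs are used.
module Analysis {c ℓ₁ ℓ₂} (F : OrderedField c ℓ₁ ℓ₂) where
  open OrderedField F
  open Model F
  open OrderedFieldProperties F
  open ChainProperties F
  open ExecutionProperties F
  open ≤-Reasoning

  module On
    (f : Carrier → Carrier) (m t : ℕ) {ε δ : Carrier}
    (0<ε : 0# < ε) (0<δ : 0# < δ) (δ<1 : δ < 1#)
    {a b a′ b′ : ℕ} (N time : ℕ) (tester : Config (suc a) b) (test : Config (suc a′) b′)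
    (halts : HaltsWithin 2 (suc m) N tester)
    (testerCorrect : ∀ (p q : Vector Carrier (suc m)) → IsDistribution p → IsDistribution q →
      (∥ p ⊖ q ∥₁ ≤ f ε → 1# - δ ÷ ι (suc m) ≤ prob (samples p q) N true tester) ×
      (ε < ∥ p ⊖ q ∥₁ → 1# - δ ÷ ι (suc m) ≤ prob (samples p q) N false tester))
    (runs : ∀ (M : Matrix (suc m) (suc m)) → IsMarkovChain M → ∀ answer →
      (b : ℕ → Carrier) (r : Carrier) →
      b 0 ≤ indicator answer true → r ≤ indicator answer false →
      (∀ (u : Fin (suc m)) k → toℕ u ≡ suc k → b (suc k) ≤
        value (samples ((M ^ t) u) ((M ^ t) zero)) (λ accept → if accept then b k else r)
          N tester) →
      Reaches M answer time (b m) test) where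

    n : ℕ
    n = suc m

    δ′ : Carrier
    δ′ = δ ÷ ι n

    0<δ′ : 0# < δ′
    0<δ′ = 0<÷ι m 0<δ

    0≤ιδ′ : ∀ k → 0# ≤ ι k * δ′
    0≤ιδ′ k = *-nonNegative (0≤ι k) (<⇒≤ 0<δ′)

    δ≈δ′+mδ′ : δ ≈ δ′ + ι m * δ′
    δ≈δ′+mδ′ = x≈x÷ι+k*[x÷ι] m δ

    0≤1-δ′ : 0# ≤ 1# - δ′
    0≤1-δ′ = x≤y⇒0≤y-x (<⇒≤ (÷ι<1 m 0<δ δ<1))

    1-δ′≤1 : 1# - δ′ ≤ 1#
    1-δ′≤1 = ≤-respʳ-≈ (x-y+y≈x 1# δ′) (0≤y⇒x≤x+y (1# - δ′) (<⇒≤ 0<δ′))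

    module Bounds (M : Matrix n n) (Markov : IsMarkovChain M) where

      walk : Fin n → Vector Carrier n
      walk = M ^ t

      walk-isDistribution : ∀ u → IsDistribution (walk u)
      walk-isDistribution = ^-isMarkovChain Markov t

      endpoints : Fin n → Matrix 2 n
      endpoints u = samples (walk u) (walk zero)

      -- The probability that the tester gives the answer in run u.
      pr : Fin n → Bool → Carrier
      pr u answer = prob (endpoints u) N answer tester

      pr-total : ∀ u → pr u true + pr u false ≈ 1#
      pr-total u = prob-total stochastic N tester halts
        where
        stochastic = samples-isDistribution (walk-isDistribution u) (walk-isDistribution zero)

      0≤pr : ∀ u answer → 0# ≤ pr u answer
      0≤pr u answer = prob-nonNegative (λ i → proj₁ (stochastic i)) answer N tester
        where
        stochastic = samples-isDistribution (walk-isDistribution u) (walk-isDistribution zero)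

      outcome : Carrier → Carrier → Bool → Carrier
      outcome x r accept = if accept then x else r

      value-outcome : ∀ u x r →
        value (endpoints u) (outcome x r) N tester ≈ pr u true * x + pr u false * r
      value-outcome u x r = value-linear (outcome x r) N tester

      value-outcome-nonNegative : ∀ u {x r} → 0# ≤ x → 0# ≤ r →
        0# ≤ value (endpoints u) (outcome x r) N tester
      value-outcome-nonNegative u {x} {r} 0≤x 0≤r = ≤-respʳ-≈ (sym (value-outcome u x r))
        (≤-respˡ-≈ (+-identityˡ 0#)
          (+-mono-≤ (*-nonNegative (0≤pr u true) 0≤x) (*-nonNegative (0≤pr u false) 0≤r)))

      -- Halting does not involve probabilities, so the trivial bound 0 gives it.
      test-halts : HaltsWithin n n time test
      test-halts = halting (runs M Markov true (λ _ → 0#) 0# 0≤1 ≤-refl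
        (λ u k _ → value-outcome-nonNegative u ≤-refl ≤-refl))

      module _ (mixing : IsMixing M (f ε ÷ ι 2) t) where

        close : ∀ u → ∥ walk u ⊖ walk zero ∥₁ ≤ f ε
        close u = begin
          ∥ walk u ⊖ walk zero ∥₁                 ≤⟨ ⊖-triangle (walk u) (walk zero) s ⟩
          ∥ walk u ⊖ s ∥₁ + ∥ walk zero ⊖ s ∥₁    ≤⟨ +-mono-≤ (near u) (near zero) ⟩
          f ε ÷ ι 2 + f ε ÷ ι 2                   ≈⟨ x÷2+x÷2≈x (f ε) ⟩
          f ε                                     ∎
          where
          s : Vector Carrier n
          s = proj₁ mixing
          near : ∀ u → ∥ walk u ⊖ s ∥₁ ≤ f ε ÷ ι 2
          near u = ≤-trans (⊖-mono-≈ s (λ i → sym (e-∙ u (M ^ t) i))) (proj₂ (proj₂ mixing) u)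

        -- The union bound for k runs.
        remaining : ℕ → Carrier
        remaining k = 1# - ι k * δ′

        remaining-suc : ∀ (u : Fin n) k → remaining (suc k) ≤
          value (endpoints u) (outcome (remaining k) 0#) N tester
        remaining-suc u k = begin
          1# - ι (suc k) * δ′       ≈⟨ +-congˡ (-‿cong (ι-suc-* k δ′)) ⟩
          1# - (δ′ + x)             ≈⟨ x-[y+z]≈[x-y]-z 1# δ′ x ⟩
          (1# - δ′) - x             ≤⟨ +-mono-≤ accepted (-‿mono-≤ px≤x) ⟩
          p - p * x                 ≈⟨ +-congʳ (*-identityʳ p) ⟨
          p * 1# - p * x            ≈⟨ x[y-z]≈xy-xz p 1# x ⟨
          p * (1# - x)              ≈⟨ +-identityʳ _ ⟨
          p * (1# - x) + 0#         ≈⟨ +-congˡ (zeroʳ (pr u false)) ⟨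
          p * (1# - x) + pr u false * 0# ≈⟨ value-outcome u (remaining k) 0# ⟨
          value (endpoints u) (outcome (remaining k) 0#) N tester ∎
          where
          x p : Carrier
          x = ι k * δ′
          p = pr u true
          accepted : 1# - δ′ ≤ p
          accepted = proj₁ (testerCorrect (walk u) (walk zero)
            (walk-isDistribution u) (walk-isDistribution zero)) (close u)
          p≤1 : p ≤ 1#
          p≤1 = ≤-respʳ-≈ (pr-total u) (0≤y⇒x≤x+y p (0≤pr u false))
          px≤x : p * x ≤ x
          px≤x = ≤-respʳ-≈ (*-identityˡ x) (*-monoʳ-≤ (0≤ιδ′ k) p≤1)

        accepts : 1# - δ < prob M time true test
        accepts = begin-strict
          1# - δ                        <⟨ 0<y⇒x<x+y (1# - δ) 0<δ′ ⟩
          (1# - δ) + δ′                 ≈⟨ +-congʳ (+-congˡ (-‿cong (trans δ≈δ′+mδ′ (+-comm _ _)))) ⟩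
          (1# - (ι m * δ′ + δ′)) + δ′   ≈⟨ +-congʳ (x-[y+z]≈[x-y]-z 1# _ δ′) ⟩
          ((1# - ι m * δ′) - δ′) + δ′   ≈⟨ x-y+y≈x _ δ′ ⟩
          remaining m                   ≤⟨ probability (runs M Markov true
                                             remaining 0# remaining₀ ≤-refl
                                             (λ u k _ → remaining-suc u k)) ⟩
          prob M time true test        ∎
          where
          remaining₀ : remaining 0 ≤ 1#
          remaining₀ = ≤-respʳ-≈ (x-y+y≈x 1# _) (0≤y⇒x≤x+y (remaining 0) (0≤ιδ′ 0))

      module _ (¬mixing : ¬ IsMixing M ε t) where

        far : ∃[ u ] ε < ∥ walk u ⊖ walk zero ∥₁
        far with Fin.¬∀⟶∃¬ n (λ u → ∥ walk u ⊖ walk zero ∥₁ ≤ ε)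
                   (λ u → ∥ walk u ⊖ walk zero ∥₁ ≤? ε)
                   (λ near → ¬mixing (walk zero , walk-isDistribution zero , λ u →
                     ≤-trans (⊖-mono-≈ (walk zero) (e-∙ u (M ^ t))) (near u)))
        ... | u , ¬near = u , ≰⇒> ¬near

        u* : Fin n
        u* = proj₁ far

        u*≢0 : u* ≢ zero
        u*≢0 u*≡0 = proj₂ (proj₂ far) (antisym (proj₁ (proj₂ far)) (≤-trans
          (≡.subst (λ u → ∥ walk u ⊖ walk zero ∥₁ ≤ 0#) (≡.sym u*≡0) (∥p⊖p∥≤0 (walk zero)))
          (<⇒≤ 0<ε)))

        0<u* : 0 ℕ.< toℕ u*
        0<u* = ℕ.n≢0⇒n>0 (λ eq → u*≢0 (Fin.toℕ-injective eq))

        -- A lower bound on the probability of rejection when the runs with numbers at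
        -- most k remain: it is 0 if the run for u* is over.
        certain : ℕ → Carrier
        certain k = if does (toℕ u* ℕ.≤? k) then 1# - δ′ else 0#

        certain-yes : ∀ {k} → toℕ u* ℕ.≤ k → certain k ≡ 1# - δ′
        certain-yes {k} u*≤k =
          ≡.cong (if_then 1# - δ′ else 0#) (dec-true (toℕ u* ℕ.≤? k) u*≤k)

        certain-no : ∀ {k} → k ℕ.< toℕ u* → certain k ≡ 0#
        certain-no {k} k<u* =
          ≡.cong (if_then 1# - δ′ else 0#) (dec-false (toℕ u* ℕ.≤? k) (ℕ.<⇒≱ k<u*))

        0≤certain : ∀ k → 0# ≤ certain k
        0≤certain k with does (toℕ u* ℕ.≤? k)
        ... | true  = 0≤1-δ′
        ... | false = ≤-refl

        certain≤1 : ∀ k → certain k ≤ 1#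
        certain≤1 k with does (toℕ u* ℕ.≤? k)
        ... | true  = 1-δ′≤1
        ... | false = 0≤1

        -- A lower bound for the remaining runs is one also before a run, since a
        -- rejection is final.
        persists : ∀ u {x} → x ≤ 1# →
          x ≤ value (endpoints u) (outcome x 1#) N tester
        persists u {x} x≤1 = begin
          x                                ≈⟨ *-identityˡ x ⟨
          1# * x                           ≈⟨ *-congʳ (pr-total u) ⟨
          (pr u true + pr u false) * x     ≈⟨ distribʳ x _ _ ⟩
          pr u true * x + pr u false * x   ≤⟨ +-monoʳ-≤ _ (*-monoˡ-≤ (0≤pr u false) x≤1) ⟩
          pr u true * x + pr u false * 1#  ≈⟨ value-outcome u x 1# ⟨
          value (endpoints u) (outcome x 1#) N tester ∎

        -- The run for u* rejects with probability at least 1 - δ/n.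
        decisive : ∀ {x} → 0# ≤ x →
          1# - δ′ ≤ value (endpoints u*) (outcome x 1#) N tester
        decisive {x} 0≤x = begin
          1# - δ′                            ≤⟨ proj₂ (testerCorrect (walk u*) (walk zero)
            (walk-isDistribution u*) (walk-isDistribution zero)) (proj₂ far) ⟩
          pr u* false                        ≈⟨ +-identityˡ _ ⟨
          0# + pr u* false                   ≤⟨ +-monoˡ-≤ _ (*-nonNegative (0≤pr u* true) 0≤x) ⟩
          pr u* true * x + pr u* false       ≈⟨ +-congˡ (*-identityʳ _) ⟨
          pr u* true * x + pr u* false * 1#  ≈⟨ value-outcome u* x 1# ⟨
          value (endpoints u*) (outcome x 1#) N tester ∎

        certain-suc : ∀ (u : Fin n) k → toℕ u ≡ suc k → certain (suc k) ≤
          value (endpoints u) (outcome (certain k) 1#) N tester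
        certain-suc u k u≡ with ℕ.<-cmp (toℕ u*) (suc k)
        ... | tri< u*<1+k _ _ = ≤-trans
          (≤-reflexive (reflexive (≡.trans (certain-yes (ℕ.<⇒≤ u*<1+k))
            (≡.sym (certain-yes (ℕ.s≤s⁻¹ u*<1+k))))))
          (persists u (certain≤1 k))
        ... | tri> _ _ 1+k<u* = ≤-trans (≤-reflexive (reflexive (certain-no 1+k<u*)))
          (value-outcome-nonNegative u (0≤certain k) 0≤1)
        ... | tri≈ _ u*≡1+k _ with Fin.toℕ-injective (≡.trans u*≡1+k (≡.sym u≡))
        ...   | ≡.refl = ≤-trans
          (≤-reflexive (reflexive (certain-yes (ℕ.≤-reflexive u*≡1+k))))
          (decisive (0≤certain k))

        rejects : 1# - δ′ ≤ prob M time false test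
        rejects = ≤-trans
          (≤-reflexive (reflexive (≡.sym (certain-yes (Fin.toℕ≤pred[n] u*)))))
          (probability (runs M Markov false certain 1#
            (≤-reflexive (reflexive (certain-no 0<u*))) ≤-refl certain-suc))

        accepts-rarely : prob M time true test < δ
        accepts-rarely = begin-strict
          prob M time true test  ≤⟨ +-cancelʳ-≤ (1# - δ′) bound ⟩
          δ′                      <⟨ 0<y⇒x<x+y δ′ 0<mδ′ ⟩
          δ′ + ι m * δ′           ≈⟨ δ≈δ′+mδ′ ⟨
          δ                       ∎
          where
          bound : prob M time true test + (1# - δ′) ≤ δ′ + (1# - δ′)
          bound = begin
            prob M time true test + (1# - δ′) ≤⟨ +-monoʳ-≤ _ rejects ⟩
            prob M time true test + prob M time false test
              ≈⟨ prob-total Markov time test test-halts ⟩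
            1#                                 ≈⟨ x-y+y≈x 1# δ′ ⟨
            (1# - δ′) + δ′                     ≈⟨ +-comm _ δ′ ⟩
            δ′ + (1# - δ′)                     ∎
          0<mδ′ : 0# < ι m * δ′
          0<mδ′ = begin-strict
            0#       <⟨ 0<δ′ ⟩
            δ′       ≈⟨ *-identityˡ δ′ ⟨
            1# * δ′  ≈⟨ *-congʳ (+-identityʳ 1#) ⟨
            ι 1 * δ′ ≤⟨ *-monoʳ-≤ (<⇒≤ 0<δ′) (ι-mono-≤ (ℕ.≤-trans 0<u* (Fin.toℕ≤pred[n] u*))) ⟩
            ι m * δ′ ∎

theorem27 : ∀ {c ℓ₁ ℓ₂} (F : OrderedField c ℓ₁ ℓ₂) →
    let open OrderedField F
        open Model F
    in
    (f : Carrier → Carrier) (T : ℕ → Carrier → Carrier → Carrier) →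
    L1Tester f T →
    Σ[ test ∈ Program 2 2 ] Σ[ C ∈ ℕ ]
      (∀ n .{{_ : NonZero n}} (t : ℕ) (ε δ : Carrier) →
        0# < ε → 0# < δ → δ < 1# →
        let start = initial test (n ∷ t ∷ []) (ε ∷ δ ∷ []) in
        Σ[ N ∈ ℕ ]
          ( (1 ℕ.≤ t → ι N ≤ ι C * (ι n * ι t * T n ε (δ ÷ ι n)))
          × HaltsWithin n n N start
          × (∀ (M : Matrix n n) → IsMarkovChain M →
               (IsMixing M (f ε ÷ ι 2) t → 1# - δ < prob M N true start)
             × (¬ IsMixing M ε t → prob M N true start < δ))))
theorem27 F f T tester =
  TestProgram.test program , TestProgram.overheads program ℕ.+ 17 , λ where
    zero → contradiction ≡.refl (ℕ.≢-nonZero⁻¹ 0)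
    (suc m) → theorem m
  where
  open OrderedField F
  open Model F
  open OrderedFieldProperties F
  open ChainProperties F
  open ExecutionProperties F
  open L1Tester tester using (program; correct)
  open TestProgram program using (test; overheads; testTime; testTime-bound)
  open ≤-Reasoning

  C : ℕ
  C = overheads ℕ.+ 17

  theorem : ∀ m (t : ℕ) (ε δ : Carrier) → 0# < ε → 0# < δ → δ < 1# →
    let n = suc m
        start = initial test (n ∷ t ∷ []) (ε ∷ δ ∷ [])
    in Σ[ N ∈ ℕ ]
      ( (1 ℕ.≤ t → ι N ≤ ι C * (ι n * ι t * T n ε (δ ÷ ι n)))
      × HaltsWithin n n N start
      × (∀ (M : Matrix n n) → IsMarkovChain M →
           (IsMixing M (f ε ÷ ι 2) t → 1# - δ < prob M N true start)
         × (¬ IsMixing M ε t → prob M N true start < δ)))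
  theorem m t ε δ 0<ε 0<δ δ<1
    with correct (suc m) ε (δ ÷ ι (suc m)) 0<ε (0<÷ι m 0<δ) (÷ι<1 m 0<δ δ<1)
  ... | N , N≤T , halts , testerCorrect =
    testTime t N m , bound , A.Bounds.test-halts e e-isMarkovChain ,
    λ M Markov → A.Bounds.accepts M Markov , A.Bounds.accepts-rarely M Markov
    where
    module A = Analysis.On F f m t 0<ε 0<δ δ<1 N (testTime t N m)
      (L1Tester.start tester (suc m) ε (δ ÷ ι (suc m)))
      (initial test (suc m ∷ t ∷ []) (ε ∷ δ ∷ [])) halts testerCorrect
      (λ M Markov answer → Running.On.reaches-test F program m M Markov answer t ε δ N halts)
    n = suc m
    bound : 1 ℕ.≤ t → ι (testTime t N m) ≤ ι C * (ι n * ι t * T n ε (δ ÷ ι n))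
    bound 1≤t = begin
      ι (testTime t N m)
        ≤⟨ ι-mono-≤ (testTime-bound t N m 1≤t (HaltsWithin⇒positive N halts)) ⟩
      ι (C ℕ.* (n ℕ.* t ℕ.* N))    ≈⟨ ι-homo-* C (n ℕ.* t ℕ.* N) ⟩
      ι C * ι (n ℕ.* t ℕ.* N)
        ≈⟨ *-congˡ (trans (ι-homo-* (n ℕ.* t) N) (*-congʳ (ι-homo-* n t))) ⟩
      ι C * (ι n * ι t * ι N)
        ≤⟨ *-monoˡ-≤ (0≤ι C) (*-monoˡ-≤ (*-nonNegative (0≤ι n) (0≤ι t)) N≤T) ⟩
      ι C * (ι n * ι t * T n ε (δ ÷ ι n)) ∎
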